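{- Let $a\in\mathbb{N}$ be a positive integer. Then there is $n_0=n_0(a)$ such that for every $n\ge n_0$ the $(a:a)$ Maker-Breaker perfect matching game $\mathcal{M}_n$ on $E(K_n)$ satisfies $$\tau_{\mathcal{M}_n}(a:a)=\begin{cases}\frac{n}{2a}+1, & \text{if } a=1 \text{ and } n \text{ is even},\\ \left\lceil \frac{n}{2a}\right\rceil-1, & \text{if } 2a\mid n-1,\\ \left\lceil \frac{n}{2a}\right\rceil, & \text{otherwise.}\end{cases}$$
   Context: In the $(a:a)$ Maker-Breaker game with board $X=E(K_n)$ (the edge set of the complete graph on $n$ vertices) and family of winning sets $\mathcal{F}\subseteq 2^X$, Breaker and Maker alternately claim $a$ previously unclaimed elements of $X$ per move (fewer if fewer remain), and Breaker moves first. Maker wins at the moment she has claimed all elements of some $F\in\mathcal{F}$ (this may happen before she has used all $a$ steps of her move); if she has not done so by the time all of $X$ is claimed, Breaker wins. $\tau_{\mathcal{F}}(a:a)$ denotes the least number of moves $t$ such that Maker has a strategy to win the $(a:a)$ game $\mathcal{F}$ within $t$ of her moves, against any strategy of Breaker ($\tau_{\mathcal F}(a:a)=\infty$ if Breaker has a winning strategy). In the perfect matching game $\mathcal{M}_n$ the winning sets are all sets of $\lfloor n/2\rfloor$ pairwise disjoint edges of $K_n$ (so for odd $n$ the matching covers all but one vertex). -}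

module Defs where

open import Data.Bool using (if_then_else_)
open import Data.Fin using (Fin) renaming (_<_ to _<ᶠ_)
open import Data.List using (List; []; _∷_; _++_; length; concatMap)
open import Data.List.Membership.Propositional using (_∈_; _∉_)
open import Data.List.Relation.Binary.Subset.Propositional using (_⊆_)
open import Data.List.Relation.Unary.All using (All)
open import Data.List.Relation.Unary.AllPairs using (AllPairs)
open import Data.List.Relation.Unary.Unique.Propositional using (Unique)
open import Data.Nat
  using (ℕ; zero; suc; _+_; _*_; _∸_; _≤_; _<_; _/_; _≟_; ⌊_/2⌋; NonZero)
open import Data.Nat.Divisibility using (_∣?_)
open import Data.Nat.Properties using (m*n≢0)
open import Data.Product using (Σ-syntax; ∃-syntax; _×_; _,_; proj₁; proj₂)
open import Data.Sum using (_⊎_)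
open import Level using (0ℓ)
open import Relation.Binary.PropositionalEquality using (_≡_)
open import Relation.Nullary using (¬_)
open import Relation.Nullary.Decidable using (⌊_⌋; _×-dec_)
open import Relation.Unary using (Pred)

-- The (a : a) Maker-Breaker game with Breaker moving first.  The board is the
-- whole type X; a finite subset of X is given by a list of its elements, so
-- 𝓕 is the family of (lists enumerating) winning sets.
module MakerBreaker (X : Set) (𝓕 : Pred (List X) 0ℓ) (a : ℕ) where

  -- A legal move when the elements of c are already claimed.  Fewer than a
  -- elements may be claimed only if this exhausts the board.
  record Move (c : List X) : Set where
    field
      picks     : List X
      distinct  : Unique picks
      unclaimed : All (_∉ c) picks
      size      : length picks ≡ a
                ⊎ (length picks < a × (∀ x → x ∈ picks ++ c))

  open Move public

  -- A round is Breaker's picks followed by Maker's picks; the latest round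
  -- comes first.
  History : Set
  History = List (List X × List X)

  makerClaimed : History → List X
  makerClaimed = concatMap proj₂

  claimed : History → List X
  claimed = concatMap (λ (b , m) → m ++ b)

  BreakerStrategy : Set
  BreakerStrategy = (h : History) → Move (claimed h)

  -- Maker also sees Breaker's picks b in the current round.
  MakerStrategy : Set
  MakerStrategy = (h : History) (b : List X) → Move (b ++ claimed h)

  play : BreakerStrategy → MakerStrategy → ℕ → History
  play β μ zero    = []
  play β μ (suc k) = (b , m) ∷ h
    where
    h = play β μ k
    b = picks (β h)
    m = picks (μ h b)

  -- Play is not cut off once Maker has won: claimed elements are never lost,
  -- so a win in the middle of her k-th move is still visible after it and
  -- counts as a win within k moves.
  MakerHasWon : History → Set
  MakerHasWon h = ∃[ F ] 𝓕 F × F ⊆ makerClaimed h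

  MakerWinsWithin : ℕ → Set
  MakerWinsWithin t =
    Σ[ μ ∈ MakerStrategy ] (∀ (β : BreakerStrategy) → MakerHasWon (play β μ t))

  -- IsTau t says that τ_𝓕(a : a) is the natural number t; τ_𝓕(a : a) = ∞
  -- corresponds to there being no such t.
  IsTau : ℕ → Set
  IsTau t = MakerWinsWithin t × (∀ s → MakerWinsWithin s → t ≤ s)

-- An edge of K_n is stored with its endpoints in increasing order, so that
-- propositional equality is equality of edges.
record Edge (n : ℕ) : Set where
  constructor edge
  field
    lo hi  : Fin n
    .lo<hi : lo <ᶠ hi

_∈ᵉ_ : ∀ {n} → Fin n → Edge n → Set
v ∈ᵉ e = v ≡ Edge.lo e ⊎ v ≡ Edge.hi e

Disjoint : ∀ {n} → Edge n → Edge n → Set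
Disjoint e f = ∀ v → ¬ (v ∈ᵉ e × v ∈ᵉ f)

-- No edge is disjoint from itself, so the listed edges are distinct.
PerfectMatching : ∀ n → Pred (List (Edge n)) 0ℓ
PerfectMatching n es = length es ≡ ⌊ n /2⌋ × AllPairs Disjoint es

⌈_/_⌉ : (m d : ℕ) .{{_ : NonZero d}} → ℕ
⌈ m / d ⌉ = (m + (d ∸ 1)) / d

optimalTime : (a n : ℕ) .{{_ : NonZero a}} → ℕ
optimalTime a n =
  if ⌊ (a ≟ 1) ×-dec (2 ∣? n) ⌋ then n / (2 * a) + 1
  else if ⌊ (2 * a) ∣? (n ∸ 1) ⌋ then ⌈ n / (2 * a) ⌉ ∸ 1
  else ⌈ n / (2 * a) ⌉
  where
  instance
    2a≢0 : NonZero (2 * a)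
    2a≢0 = m*n≢0 2 a

{-# OPTIONS --safe #-}
module Submission where

-- Breaker's picks hurt Maker only inside the set U of vertices not yet covered.  Maker answers
-- the at most a new edges inside U by a disjoint free edges meeting all of them, so after each
-- of her moves no edge inside U is Breaker's, and no edge of hers is wasted until the last move.
-- If ⌊n/2⌋ = q + c a with 1 ≤ q ≤ a, this leaves 2 q or 2 q + 1 vertices for move c + 1.  With
-- q = a they are matched directly (for 2 a vertices and a ≥ 2 by first meeting two of Breaker's
-- edges at once).  With q < a the spare edges serve to match pairs u, v of uncovered vertices
-- through an earlier edge xy by ux and vy: blocking both ways through xy costs Breaker two edges
-- for each xy, more than he has claimed.
--
-- For a = 1 and n even, Breaker takes the last edge that Maker lacks, so one edge is wasted.
-- Maker wastes it when four vertices remain, turning an edge xy into a path p - x - y whose two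
-- ends give her a double threat at the end.

open import Defs

open import Data.Bool using (if_then_else_)
open import Data.Empty using (⊥)
open import Data.Empty.Irrelevant renaming (⊥-elim to ⊥-elim-irr)
open import Data.Fin using (Fin)
open import Data.Fin.Properties using ()
  renaming (_≟_ to _≟ᶠ_; _<?_ to _<ᶠ?_; <-cmp to <ᶠ-cmp; <-irrefl to <ᶠ-irrefl; <-asym to <ᶠ-asym)
open import Data.List
  using (List; []; _∷_; _++_; length; filter; take; deduplicate; allFin; concatMap)
open import Data.List.Membership.Propositional using (_∈_; _∉_; find; lose)
open import Data.List.Membership.Propositional.Properties
  using (∈-∃++; ∈-++⁺ˡ; ∈-++⁺ʳ; ∈-++⁻; ∈-filter⁺; ∈-filter⁻; ∈-allFin; ∈-concatMap⁺;
         ∈-deduplicate⁺; ∈-deduplicate⁻)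
open import Data.List.Properties
  using (≡-dec; filter-++; filter-accept; filter-notAll; filter-reject; filter-some;
         length-++; length-filter; length-tabulate; length-take; take-all)
open import Data.List.Relation.Binary.Subset.Propositional using (_⊆_)
open import Data.List.Relation.Unary.All as All using (All; []; _∷_)
import Data.List.Relation.Unary.All.Properties as All
open import Data.List.Relation.Unary.AllPairs as AllPairs using (AllPairs; []; _∷_)
import Data.List.Relation.Unary.AllPairs.Properties as AllPairs
open import Data.List.Relation.Unary.Any as Any using (Any; here; there; any?)
open import Data.List.Relation.Unary.Unique.Propositional using (Unique)
import Data.List.Relation.Unary.Unique.DecPropositional.Properties as DecUnique
import Data.List.Relation.Unary.Unique.Propositional.Properties as Unique
open import Data.Maybe using (Maybe; just; nothing; _>>=_)
open import Data.Nat
open import Data.Nat.DivMod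
open import Data.Nat.Divisibility
open import Data.Nat.Properties
open import Data.Nat.Tactic.RingSolver using (solve-∀)
open import Data.Product
open import Data.Sum using (_⊎_; inj₁; inj₂; [_,_]′)
open import Function using (_∘_; id)
open import Level using (0ℓ)
open import Relation.Binary.Definitions using (DecidableEquality; tri<; tri≈; tri>)
open import Relation.Binary.PropositionalEquality
open import Relation.Nullary using (¬_; Dec; yes; no; contradiction; ¬?; _×-dec_; _⊎-dec_)
open import Relation.Nullary.Decidable using (⌊_⌋)
open import Relation.Unary using (Pred; Decidable)

-- Counting in lists

-- A vertex u of U has a free partner in U as long as at most |U| - 2 of Breaker's edges inside U
-- contain u. Hence k pairs can be matched with r vertices of U left over, each of Maker's edges
-- meeting one of his b edges inside U, when b ≤ k + r - 1. For b = k = a this asks for r ≥ 1, which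
-- holds before the last move, and in it for 2 a + 1 vertices. With 2 a vertices the count is short
-- by one, as Breaker may join the last two; meeting two of his edges at once gains the missing one,
-- but for a = 1 there is no second edge to meet. With q < a pairs, a edges of Breaker may be too
-- dense in U to be met directly, whereas augmentation depends only on his total. If k pairs take
-- one edge and t pairs take two, then k + t = q and k + 2 t ≤ a. His at most (c + 1) a edges and
-- the at most a edges for augmenting stay within 2 c a as soon as c ≥ 2; large n provides this.
-- Outside the exceptional case the lower bound only counts edges: c a < ⌊n/2⌋ forces move c + 1.

module _ where

  private variable
    A B : Set
    P Q : Pred A 0ℓ

  length-⊆ : {xs ys : List A} → Unique xs → xs ⊆ ys → length xs ≤ length ys
  length-⊆ [] _ = z≤n
  length-⊆ {xs = x ∷ xs} (x≢xs ∷ xs!) xs⊆ys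
    with as , bs , refl ← ∈-∃++ (xs⊆ys (here refl)) = begin
      suc (length xs)             ≤⟨ s≤s (length-⊆ xs! xs⊆as++bs) ⟩
      suc (length (as ++ bs))     ≡⟨ cong suc (length-++ as) ⟩
      suc (length as + length bs) ≡⟨ +-suc (length as) (length bs) ⟨
      length as + suc (length bs) ≡⟨ length-++ as ⟨
      length (as ++ x ∷ bs)       ∎
    where
    open ≤-Reasoning
    xs⊆as++bs : xs ⊆ as ++ bs
    xs⊆as++bs z∈xs with ∈-++⁻ as (xs⊆ys (there z∈xs))
    ... | inj₁ z∈as         = ∈-++⁺ˡ z∈as
    ... | inj₂ (here refl)  = contradiction refl (All.lookup x≢xs z∈xs)
    ... | inj₂ (there z∈bs) = ∈-++⁺ʳ as z∈bs

  module _ (_≟ᴬ_ : DecidableEquality A) where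

    open import Data.List.Membership.DecPropositional _≟ᴬ_ using (_∈?_)

    ⊆-reverse : {xs ys : List A} → Unique xs → xs ⊆ ys → length ys ≤ length xs → ys ⊆ xs
    ⊆-reverse {xs} xs! xs⊆ys ys≤xs {y} y∈ys with y ∈? xs
    ... | yes y∈xs = y∈xs
    ... | no  y∉xs = contradiction ys≤xs (<⇒≱ (length-⊆ (All.tabulate y≢ ∷ xs!) y∷xs⊆ys))
      where
      y≢ : ∀ {x} → x ∈ xs → y ≢ x
      y≢ x∈xs refl = y∉xs x∈xs
      y∷xs⊆ys : y ∷ xs ⊆ _
      y∷xs⊆ys (here refl)  = y∈ys
      y∷xs⊆ys (there z∈xs) = xs⊆ys z∈xs

    remove : A → List A → List A
    remove x = filter (λ y → ¬? (y ≟ᴬ x))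

    ∈-remove⁺ : ∀ {x y xs} → y ∈ xs → y ≢ x → y ∈ remove x xs
    ∈-remove⁺ = ∈-filter⁺ _

    ∈-remove⁻ : ∀ {x y xs} → y ∈ remove x xs → y ∈ xs × y ≢ x
    ∈-remove⁻ = ∈-filter⁻ _

    length-remove : ∀ x {xs} → Unique xs → length xs ≤ suc (length (remove x xs))
    length-remove x {xs} xs! = length-⊆ xs! xs⊆
      where
      xs⊆ : xs ⊆ x ∷ remove x xs
      xs⊆ {y} y∈xs with y ≟ᴬ x
      ... | yes refl = here refl
      ... | no  y≢x  = there (∈-remove⁺ y∈xs y≢x)

  module _ {P : Pred A 0ℓ} (P? : Decidable P) where

    count : List A → ℕ
    count xs = length (filter P? xs)

    count-++ : ∀ xs ys → count (xs ++ ys) ≡ count xs + count ys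
    count-++ xs ys = trans (cong length (filter-++ P? xs ys)) (length-++ (filter P? xs))

  count-complement : (P? : Decidable P) → ∀ xs →
    count P? xs + count (¬? ∘ P?) xs ≡ length xs
  count-complement P? [] = refl
  count-complement P? (x ∷ xs) with P? x
  ... | yes _ = cong suc (count-complement P? xs)
  ... | no  _ = trans (+-suc _ _) (cong suc (count-complement P? xs))

  count-mono : (P? : Decidable P) (Q? : Decidable Q) → ∀ xs →
    (∀ {x} → x ∈ xs → P x → Q x) → count P? xs ≤ count Q? xs
  count-mono P? Q? [] P⇒Q = z≤n
  count-mono P? Q? (x ∷ xs) P⇒Q with ih ← count-mono P? Q? xs (P⇒Q ∘ there) | P? x | Q? x
  ... | yes _  | yes _  = s≤s ih
  ... | yes px | no ¬qx = contradiction (P⇒Q (here refl) px) ¬qx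
  ... | no _   | yes _  = m≤n⇒m≤1+n ih
  ... | no _   | no _   = ih

  count-filter : (P? : Decidable P) (Q? : Decidable Q) → ∀ xs →
    (∀ {x} → x ∈ xs → P x → Q x) → count P? xs ≤ count P? (filter Q? xs)
  count-filter P? Q? [] P⇒Q = z≤n
  count-filter P? Q? (x ∷ xs) P⇒Q with ih ← count-filter P? Q? xs (P⇒Q ∘ there) | Q? x
  ... | yes _ with P? x
  ...   | yes _ = s≤s ih
  ...   | no  _ = ih
  count-filter P? Q? (x ∷ xs) P⇒Q | no ¬qx with P? x
  ...   | yes px = contradiction (P⇒Q (here refl) px) ¬qx
  ...   | no  _  = ih

  module _ {R : A → B → Set} (R? : ∀ y e → Dec (R y e)) where

    -- Either the first y has fewer than k related es, or at least k of them can be deleted. As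
    -- every e is related to at most one y, the deletion does not change the counts of the other y,
    -- and induction applies.
    pigeonhole : ∀ k {ys es} → Unique ys →
      (∀ {e y y′} → e ∈ es → y ∈ ys → y′ ∈ ys → R y e → R y′ e → y ≡ y′) →
      length es < k * length ys →
      ∃ λ y → y ∈ ys × count (R? y) es < k
    pigeonhole k {[]} _ _ short = contradiction (<-≤-trans short (≤-reflexive (*-zeroʳ k))) n≮0
    pigeonhole k {y ∷ ys} {es} (y≢ys ∷ ys!) func short with count (R? y) es <? k
    ... | yes few = y , here refl , few
    ... | no many =
      let y′ , y′∈ , few = pigeonhole k {ys} {es′} ys! func′ short′
      in  y′ , there y′∈ , ≤-<-trans (count-filter (R? y′) (¬? ∘ R? y) es
            λ e∈ r′ r → All.lookup y≢ys y′∈ (func e∈ (here refl) (there y′∈) r r′)) few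
      where
      es′ = filter (¬? ∘ R? y) es
      func′ : ∀ {e y y′} → e ∈ es′ → y ∈ ys → y′ ∈ ys → R y e → R y′ e → y ≡ y′
      func′ e∈ y∈ y′∈ = func (proj₁ (∈-filter⁻ _ e∈)) (there y∈) (there y′∈)
      open ≤-Reasoning
      short′ : length es′ < k * length ys
      short′ = +-cancelˡ-< k _ _ (begin-strict
        k + length es′                  ≤⟨ +-monoˡ-≤ _ (≮⇒≥ many) ⟩
        count (R? y) es + length es′    ≡⟨ count-complement (R? y) es ⟩
        length es                       <⟨ short ⟩
        k * suc (length ys)             ≡⟨ *-suc k (length ys) ⟩
        k + k * length ys               ∎)

  count<2⇒≡ : ∀ {A : Set} {P : Pred A 0ℓ} (P? : Decidable P) {xs x y} → count P? xs < 2 →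
    x ∈ xs → P x → y ∈ xs → P y → x ≡ y
  count<2⇒≡ P? {xs} few x∈ px y∈ py with filter P? xs | few | ∈-filter⁺ P? x∈ px | ∈-filter⁺ P? y∈ py
  ... | _ ∷ []    | _ | here refl | here refl = refl
  ... | _ ∷ _ ∷ _ | s≤s (s≤s ()) | _ | _

  length-remove-∈ : ∀ {A : Set} (_≟ᴬ_ : DecidableEquality A) {x xs} → Unique xs → x ∈ xs →
    length xs ≡ suc (length (remove _≟ᴬ_ x xs))
  length-remove-∈ _≟ᴬ_ {x} {xs} xs! x∈xs = ≤-antisym (length-remove _≟ᴬ_ x xs!)
    (filter-notAll (λ y → ¬? (y ≟ᴬ x)) xs (lose x∈xs λ x≢x → x≢x refl))

  AllPairs-prefix : ∀ {A : Set} {R : A → A → Set} xs {ys} → AllPairs R (xs ++ ys) → AllPairs R xs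
  AllPairs-prefix []       _         = []
  AllPairs-prefix (x ∷ xs) (px ∷ ps) = All.++⁻ˡ xs px ∷ AllPairs-prefix xs ps

  two-elements : ∀ {A : Set} {xs : List A} → Unique xs → 2 ≤ length xs →
    ∃₂ λ u v → u ∈ xs × v ∈ xs × u ≢ v
  two-elements {xs = u ∷ v ∷ _} ((u≢v ∷ _) ∷ _) _ = u , v , here refl , there (here refl) , u≢v
  two-elements {xs = _ ∷ []} _ (s≤s ())

  four-elements : ∀ {A : Set} {xs : List A} → Unique xs → 4 ≤ length xs →
    ∃₂ λ p q → ∃₂ λ r s → Unique (p ∷ q ∷ r ∷ s ∷ []) × p ∷ q ∷ r ∷ s ∷ [] ⊆ xs
  four-elements {xs = p ∷ q ∷ r ∷ s ∷ _} xs! _ = p , q , r , s , Unique.take⁺ 4 xs! ,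
    λ { (here refl) → here refl ; (there (here refl)) → there (here refl)
      ; (there (there (here refl))) → there (there (here refl))
      ; (there (there (there (here refl)))) → there (there (there (here refl))) }
  four-elements {xs = _ ∷ []}         _ (s≤s ())
  four-elements {xs = _ ∷ _ ∷ []}     _ (s≤s (s≤s ()))
  four-elements {xs = _ ∷ _ ∷ _ ∷ []} _ (s≤s (s≤s (s≤s ())))

-- Edges and matchings

module _ {n : ℕ} where

  open Edge
  open import Data.List.Membership.DecPropositional (_≟ᶠ_ {n}) using (_∈?_)

  private variable
    u v w : Fin n
    e f : Edge n
    U V : List (Fin n)
    E M : List (Edge n)

  lo≢hi : (e : Edge n) → lo e ≢ hi e
  lo≢hi (edge _ _ lo<hi) refl = ⊥-elim-irr (<ᶠ-irrefl refl lo<hi)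

  _∈ᵉ?_ : (v : Fin n) (e : Edge n) → Dec (v ∈ᵉ e)
  v ∈ᵉ? e = v ≟ᶠ lo e ⊎-dec v ≟ᶠ hi e

  _≟ᵉ_ : DecidableEquality (Edge n)
  edge a b _ ≟ᵉ edge c d _ with a ≟ᶠ c | b ≟ᶠ d
  ... | yes refl | yes refl = yes refl
  ... | no a≢c   | _        = no λ { refl → a≢c refl }
  ... | yes _    | no b≢d   = no λ { refl → b≢d refl }

  joining : u ≢ v → ∃ λ e → u ∈ᵉ e × v ∈ᵉ e
  joining {u} {v} u≢v with <ᶠ-cmp u v
  ... | tri< u<v _ _ = edge u v u<v , inj₁ refl , inj₂ refl
  ... | tri≈ _ u≡v _ = contradiction u≡v u≢v
  ... | tri> _ _ v<u = edge v u v<u , inj₂ refl , inj₁ refl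

  endpoints : ∀ e → u ∈ᵉ e → v ∈ᵉ e → u ≢ v → w ∈ᵉ e → w ≡ u ⊎ w ≡ v
  endpoints _ (inj₁ refl) (inj₁ refl) u≢v _ = contradiction refl u≢v
  endpoints _ (inj₁ refl) (inj₂ refl) _ w∈ = w∈
  endpoints _ (inj₂ refl) (inj₁ refl) _ (inj₁ refl) = inj₂ refl
  endpoints _ (inj₂ refl) (inj₁ refl) _ (inj₂ refl) = inj₁ refl
  endpoints _ (inj₂ refl) (inj₂ refl) u≢v _ = contradiction refl u≢v

  edge-unique : ∀ e f → u ≢ v → u ∈ᵉ e → v ∈ᵉ e → u ∈ᵉ f → v ∈ᵉ f → e ≡ f
  edge-unique _ _ u≢v (inj₁ refl) (inj₁ refl) _ _ = contradiction refl u≢v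
  edge-unique _ _ u≢v (inj₂ refl) (inj₂ refl) _ _ = contradiction refl u≢v
  edge-unique _ _ u≢v _ _ (inj₁ refl) (inj₁ refl) = contradiction refl u≢v
  edge-unique _ _ u≢v _ _ (inj₂ refl) (inj₂ refl) = contradiction refl u≢v
  edge-unique _ _ u≢v (inj₁ refl) (inj₂ refl) (inj₁ refl) (inj₂ refl) = refl
  edge-unique _ _ u≢v (inj₂ refl) (inj₁ refl) (inj₂ refl) (inj₁ refl) = refl
  edge-unique (edge _ _ p) (edge _ _ q) u≢v (inj₁ refl) (inj₂ refl) (inj₂ refl) (inj₁ refl) =
    ⊥-elim-irr (<ᶠ-asym p q)
  edge-unique (edge _ _ p) (edge _ _ q) u≢v (inj₂ refl) (inj₁ refl) (inj₁ refl) (inj₂ refl) =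
    ⊥-elim-irr (<ᶠ-asym p q)

  edgesAt : Fin n → Fin n → List (Edge n)
  edgesAt u v with u <ᶠ? v
  ... | yes u<v = edge u v u<v ∷ []
  ... | no _    = []

  allEdges : List (Edge n)
  allEdges = concatMap (λ u → concatMap (edgesAt u) (allFin n)) (allFin n)

  ∈-allEdges : ∀ e → e ∈ allEdges
  ∈-allEdges (edge u v u<v) =
    ∈-concatMap⁺ (λ u → concatMap (edgesAt u) (allFin n)) (lose (∈-allFin u)
      (∈-concatMap⁺ (edgesAt u) (lose (∈-allFin v) ∈-edgesAt)))
    where
    ∈-edgesAt : edge u v u<v ∈ edgesAt u v
    ∈-edgesAt with u <ᶠ? v
    ... | yes _   = here refl
    ... | no  u≮v = ⊥-elim-irr (u≮v u<v)

  Disjoint⇒≢ : Disjoint e f → e ≢ f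
  Disjoint⇒≢ {e} disj refl = disj (lo e) (inj₁ refl , inj₁ refl)

  matching-unique : AllPairs Disjoint M → Unique M
  matching-unique = AllPairs.map Disjoint⇒≢

  matching-≡ : AllPairs Disjoint M → e ∈ M → f ∈ M → v ∈ᵉ e → v ∈ᵉ f → e ≡ f
  matching-≡ (_ ∷ _)  (here refl) (here refl) _ _ = refl
  matching-≡ (d ∷ _)  (here refl) (there f∈) v∈e v∈f = contradiction (v∈e , v∈f) (All.lookup d f∈ _)
  matching-≡ (d ∷ _)  (there e∈) (here refl) v∈e v∈f = contradiction (v∈f , v∈e) (All.lookup d e∈ _)
  matching-≡ (_ ∷ ds) (there e∈) (there f∈) v∈e v∈f = matching-≡ ds e∈ f∈ v∈e v∈f

  Avoids : List (Fin n) → List (Edge n) → Set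
  Avoids U M = ∀ {v e} → v ∈ U → e ∈ M → ¬ (v ∈ᵉ e)

  Joins : Fin n → Fin n → Edge n → Set
  Joins u v e = u ∈ᵉ e × v ∈ᵉ e

  joins? : ∀ u v → Decidable (Joins u v)
  joins? u v e = u ∈ᵉ? e ×-dec v ∈ᵉ? e

  Blocked : List (Edge n) → Fin n → Fin n → Set
  Blocked E u v = Any (Joins u v) E

  blocked? : ∀ E u v → Dec (Blocked E u v)
  blocked? E u v = any? (joins? u v) E

  ¬blocked⇒∉ : ¬ Blocked E u v → u ∈ᵉ e → v ∈ᵉ e → e ∉ E
  ¬blocked⇒∉ ¬bl u∈ v∈ e∈E = ¬bl (Any.map (λ { refl → u∈ , v∈ }) e∈E)

  Within : List (Fin n) → Edge n → Set
  Within U e = lo e ∈ U × hi e ∈ U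

  within? : ∀ U → Decidable (Within U)
  within? U e = lo e ∈? U ×-dec hi e ∈? U

  within⇒∈ : ∀ e → Within U e → v ∈ᵉ e → v ∈ U
  within⇒∈ _ (lo∈ , hi∈) (inj₁ refl) = lo∈
  within⇒∈ _ (lo∈ , hi∈) (inj₂ refl) = hi∈

  ∈⇒within : ∀ e → u ≢ v → u ∈ U → v ∈ U → Joins u v e → Within U e
  ∈⇒within {U = U} e u≢v u∈U v∈U (u∈e , v∈e) = at (inj₁ refl) , at (inj₂ refl)
    where
    at : w ∈ᵉ e → w ∈ U
    at w∈e with endpoints e u∈e v∈e u≢v w∈e
    ... | inj₁ refl = u∈U
    ... | inj₂ refl = v∈U

  inner : List (Fin n) → List (Edge n) → ℕ
  inner U = count (within? U)

  inner-mono : U ⊆ V → ∀ E → inner U E ≤ inner V E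
  inner-mono U⊆V E = count-mono (within? _) (within? _) E λ _ (p , q) → U⊆V p , U⊆V q

  _─_ : List (Fin n) → Fin n → List (Fin n)
  U ─ v = remove _≟ᶠ_ v U

  -- Each edge of E at u inside U excludes one partner, so |U| - 2 of them cannot exclude all |U| -
  -- 1 others.
  neighbour : Unique U → u ∈ U → 2 + count (u ∈ᵉ?_) (filter (within? U) E) ≤ length U →
    ∃ λ v → v ∈ U × u ≢ v × ¬ Blocked E u v
  neighbour {U} {u} {E} U! u∈U big =
    let v , v∈ , none = pigeonhole (λ v e → v ∈ᵉ? e) 1 {U ─ u} {star} (Unique.filter⁺ _ U!) func short
        v∈U , v≢u = ∈-remove⁻ _≟ᶠ_ v∈
    in v , v∈U , v≢u ∘ sym , λ bl → contradiction none (≤⇒≯ (count≥1 bl v∈U (v≢u ∘ sym)))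
    where
    inside = filter (within? U) E
    star = filter (u ∈ᵉ?_) inside
    func : ∀ {e y y′} → e ∈ star → y ∈ U ─ u → y′ ∈ U ─ u → y ∈ᵉ e → y′ ∈ᵉ e → y ≡ y′
    func {e} e∈ y∈ y′∈ y∈e y′∈e
      with u∈e ← proj₂ (∈-filter⁻ (u ∈ᵉ?_) {xs = inside} e∈)
         | y≢u ← proj₂ (∈-remove⁻ _≟ᶠ_ {xs = U} y∈)
         | y′≢u ← proj₂ (∈-remove⁻ _≟ᶠ_ {xs = U} y′∈)
      with endpoints e u∈e y∈e (y≢u ∘ sym) y′∈e
    ... | inj₁ y′≡u = contradiction y′≡u y′≢u
    ... | inj₂ y′≡y = sym y′≡y
    short : length star < 1 * length (U ─ u)
    short rewrite +-identityʳ (length (U ─ u)) = ≤-pred (≤-trans big (length-remove _≟ᶠ_ u U!))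
    count≥1 : ∀ {v} → Blocked E u v → v ∈ U → u ≢ v → 1 ≤ count (v ∈ᵉ?_) star
    count≥1 {v} bl v∈U u≢v with e , e∈E , u∈e , v∈e ← find bl =
      filter-some (v ∈ᵉ?_) (lose (∈-filter⁺ (u ∈ᵉ?_) (∈-filter⁺ (within? U) e∈E
        (∈⇒within e u≢v u∈U v∈U (u∈e , v∈e))) u∈e) v∈e)

-- Packing disjoint free edges

module _ {n : ℕ} where

  open Edge
  private variable
    u v w : Fin n
    e f : Edge n
    U V : List (Fin n)
    E M : List (Edge n)

  -- The indices carry what the later edges of the same move depend on: k edges so far, at least r
  -- vertices left over, at most c edges of E (Breaker's) inside these.
  record Packing (U : List (Fin n)) (E : List (Edge n)) (k r c : ℕ) : Set where
    field
      edges       : List (Edge n)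
      rest        : List (Fin n)
      #edges      : length edges ≡ k
      disjoint    : AllPairs Disjoint edges
      inside      : ∀ {d v} → d ∈ edges → v ∈ᵉ d → v ∈ U
      free        : ∀ {d} → d ∈ edges → d ∉ E
      rest-unique : Unique rest
      rest⊆U      : rest ⊆ U
      rest-avoids : Avoids rest edges
      #rest       : r ≤ length rest
      sparse      : inner rest E ≤ c

  open Packing

  private variable
    k k′ r r′ c c′ : ℕ

  noEdges : Unique U → r ≤ length U → inner U E ≤ c → Packing U E 0 r c
  noEdges {U} U! r≤ c≥ = record
    { edges = [] ; rest = U ; #edges = refl ; disjoint = []
    ; inside = λ () ; free = λ () ; rest-unique = U! ; rest⊆U = id
    ; rest-avoids = λ _ () ; #rest = r≤ ; sparse = c≥ }

  extend : (P : Packing U E k r c) → Packing (rest P) E k′ r′ c′ → Packing U E (k + k′) r′ c′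
  extend P Q = record
    { edges = edges P ++ edges Q
    ; rest = rest Q
    ; #edges = trans (length-++ (edges P)) (cong₂ _+_ (#edges P) (#edges Q))
    ; disjoint = AllPairs.++⁺ (disjoint P) (disjoint Q)
        (All.tabulate λ d∈P → All.tabulate λ d∈Q v (v∈p , v∈q) →
          rest-avoids P (inside Q d∈Q v∈q) d∈P v∈p)
    ; inside = λ {d} {v} d∈ v∈d →
        [ (λ d∈P → inside P {d} d∈P v∈d) , (λ d∈Q → rest⊆U P (inside Q {d} d∈Q v∈d)) ]′
          (∈-++⁻ (edges P) d∈)
    ; free = λ d∈ → [ free P , free Q ]′ (∈-++⁻ (edges P) d∈)
    ; rest-unique = rest-unique Q
    ; rest⊆U = rest⊆U P ∘ rest⊆U Q
    ; rest-avoids = λ {_} {d} v∈ d∈ v∈d →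
        [ (λ d∈P → rest-avoids P {e = d} (rest⊆U Q v∈) d∈P v∈d)
        , (λ d∈Q → rest-avoids Q {e = d} v∈ d∈Q v∈d) ]′ (∈-++⁻ (edges P) d∈)
    ; #rest = #rest Q
    ; sparse = sparse Q
    }

  weaken : r′ ≤ r → c ≤ c′ → Packing U E k r c → Packing U E k r′ c′
  weaken r′≤r c≤c′ P = record
    { edges = edges P ; rest = rest P ; #edges = #edges P ; disjoint = disjoint P
    ; inside = inside P ; free = free P ; rest-unique = rest-unique P ; rest⊆U = rest⊆U P
    ; rest-avoids = rest-avoids P ; #rest = ≤-trans r′≤r (#rest P) ; sparse = ≤-trans (sparse P) c≤c′ }

  remaining : List (Fin n) → Fin n → Fin n → List (Fin n)
  remaining U u v = (U ─ u) ─ v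

  remaining⊆ : remaining U u v ⊆ U
  remaining⊆ = proj₁ ∘ ∈-remove⁻ _≟ᶠ_ ∘ proj₁ ∘ ∈-remove⁻ _≟ᶠ_

  ∉-remaining : w ≡ u ⊎ w ≡ v → w ∉ remaining U u v
  ∉-remaining {w} {u} {v} {U} w≡ w∈ with w∈U─u , w≢v ← ∈-remove⁻ _≟ᶠ_ {xs = U ─ u} w∈ =
    [ proj₂ (∈-remove⁻ _≟ᶠ_ {xs = U} w∈U─u) , w≢v ]′ w≡

  pair : Unique U → u ∈ U → v ∈ U → u ≢ v → ¬ Blocked E u v →
    2 + r ≤ length U → inner (remaining U u v) E ≤ c → Packing U E 1 r c
  pair {U} {u} {v} U! u∈U v∈U u≢v ¬bl size few with e , u∈e , v∈e ← joining u≢v = record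
    { edges = e ∷ []
    ; rest = remaining U u v
    ; #edges = refl
    ; disjoint = [] ∷ []
    ; inside = λ { (here refl) → within⇒∈ e (∈⇒within e u≢v u∈U v∈U (u∈e , v∈e)) }
    ; free = λ { (here refl) → ¬blocked⇒∉ ¬bl u∈e v∈e }
    ; rest-unique = Unique.filter⁺ _ (Unique.filter⁺ _ U!)
    ; rest⊆U = remaining⊆
    ; rest-avoids = λ { w∈ (here refl) w∈e → ∉-remaining {U = U} (endpoints e u∈e v∈e u≢v w∈e) w∈ }
    ; #rest = ≤-pred (≤-pred (≤-trans size (≤-trans (length-remove _≟ᶠ_ u U!)
                (s≤s (length-remove _≟ᶠ_ v (Unique.filter⁺ _ U!))))))
    ; sparse = few
    }

  innerEdges : List (Fin n) → List (Edge n) → List (Edge n)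
  innerEdges U = filter (within? U)

  inner-restrict : V ⊆ U → ∀ E → inner V E ≤ inner V (innerEdges U E)
  inner-restrict V⊆U E = count-filter (within? _) (within? _) E λ _ (p , q) → V⊆U p , V⊆U q

  degree : Fin n → List (Edge n) → ℕ
  degree u = count (u ∈ᵉ?_)

  -- Whichever free partner u gets, all edges of E at u drop out of the inner count together with u.
  coverAt : Unique U → u ∈ U → 2 + inner U E ≤ length U → 2 + r ≤ length U →
    Packing U E 1 r (inner U E ∸ degree u (innerEdges U E))
  coverAt {U} {u} {E} U! u∈U sparse-enough size =
    let v , v∈U , u≢v , ¬bl = neighbour {E = E} U! u∈U
          (≤-trans (+-monoʳ-≤ 2 (length-filter (u ∈ᵉ?_) (innerEdges U E))) sparse-enough)
    in pair U! u∈U v∈U u≢v ¬bl size (few v)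
    where
    F = innerEdges U E
    open ≤-Reasoning
    missing : ∀ {v e} → Within (remaining U u v) e → ¬ (u ∈ᵉ e)
    missing {v} {e} w u∈e = ∉-remaining {U = U} (inj₁ refl) (within⇒∈ e w u∈e)
    few : ∀ v → inner (remaining U u v) E ≤ inner U E ∸ degree u F
    few v = begin
      inner (remaining U u v) E            ≤⟨ inner-restrict remaining⊆ E ⟩
      inner (remaining U u v) F
        ≤⟨ count-mono (within? (remaining U u v)) (¬? ∘ (u ∈ᵉ?_)) F (λ {e} _ → missing {v} {e}) ⟩
      count (¬? ∘ (u ∈ᵉ?_)) F              ≡⟨ m+n∸m≡n (degree u F) _ ⟨
      (degree u F + count (¬? ∘ (u ∈ᵉ?_)) F) ∸ degree u F
        ≡⟨ cong (_∸ degree u F) (count-complement (u ∈ᵉ?_) F) ⟩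
      inner U E ∸ degree u F               ∎

  -- Covering an end of some edge of E inside U lowers the count. If there is no such edge,
  -- truncated subtraction makes the bound 0 and any vertex can be covered.
  step : Unique U → 2 + inner U E ≤ length U → 2 + r ≤ length U → Packing U E 1 r (inner U E ∸ 1)
  step {U = []} _ ()
  step {U = U@(x ∷ _)} {E} {r} U! enough size = go (innerEdges U E) refl
    where
    go : ∀ F → innerEdges U E ≡ F → Packing U E 1 r (inner U E ∸ 1)
    go []      eq = weaken ≤-refl
      (≤-trans (≤-trans (m∸n≤m (inner U E) (degree x (innerEdges U E))) (≤-reflexive (cong length eq))) z≤n)
      (coverAt U! (here refl) enough size)
    go (e ∷ F) eq = weaken ≤-refl
      (∸-monoʳ-≤ (inner U E) (filter-some (lo e ∈ᵉ?_) (lose e∈ (inj₁ refl))))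
      (coverAt U! (proj₁ (proj₂ (∈-filter⁻ (within? U) {xs = E} e∈))) enough size)
      where
      e∈ : e ∈ innerEdges U E
      e∈ = subst (e ∈_) (sym eq) (here refl)

  -- The bounds b and k drop together, so the hypothesis persists. For the last edge it reads b ≤ r
  -- with r + 2 vertices present, exactly the margin that a free partner requires.
  packing : ∀ k {U b} → Unique U → 2 * k + r ≤ length U → inner U E ≤ b → b ≤ k + r ∸ 1 →
    Packing U E k r (b ∸ k)
  packing zero U! size few _ = noEdges U! size few
  packing {r} {E} (suc k) {U} {b} U! size few b≤ = extend first (subst (Packing _ _ k r) (∸-+-assoc b 1 k)
    (packing k (rest-unique first) (#rest first) (sparse first) (∸-monoˡ-≤ 1 b≤)))
    where
    size′ : 2 + (2 * k + r) ≤ length U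
    size′ = subst (λ z → z + r ≤ length U) (*-suc 2 k) size
    first : Packing U E 1 (2 * k + r) (b ∸ 1)
    first = weaken ≤-refl (∸-monoˡ-≤ 1 few)
      (step U! (≤-trans (+-monoʳ-≤ 2 (≤-trans few (≤-trans b≤ (+-monoˡ-≤ r (m≤n*m k 2))))) size′) size′)

  -- Of two edges of E inside U, either a common vertex can be covered, or an end of one can be
  -- paired with an end of the other. If that pair is itself an edge of E, then `lo e` lies on two
  -- edges of E and can be covered.
  step₂ : Unique U → 2 + inner U E ≤ length U → 2 + r ≤ length U →
    Packing U E 1 r (inner U E ∸ 2)
  step₂ {U} {E} {r} U! enough size = go (innerEdges U E) refl
    where
    Goal = Packing U E 1 r (inner U E ∸ 2)

    from-step : inner U E ≤ 1 → Goal
    from-step few = weaken ≤-refl (≤-trans (∸-monoˡ-≤ 1 few) z≤n) (step U! enough size)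

    from-cover : w ∈ U → 2 ≤ degree w (innerEdges U E) → Goal
    from-cover w∈U two = weaken ≤-refl (∸-monoʳ-≤ (inner U E) two) (coverAt U! w∈U enough size)

    module Split {e f F} (eq : innerEdges U E ≡ e ∷ f ∷ F) where

      lo∈U : ∀ {g} → g ∈ e ∷ f ∷ F → lo g ∈ U
      lo∈U {g} g∈ = proj₁ (proj₂ (∈-filter⁻ (within? U) {xs = E} (subst (g ∈_) (sym eq) g∈)))

      two : w ∈ᵉ e → Any (w ∈ᵉ_) (f ∷ F) → 2 ≤ degree w (innerEdges U E)
      two {w} w∈e w∈ rewrite eq | filter-accept (w ∈ᵉ?_) {e} {f ∷ F} w∈e =
        s≤s (filter-some (w ∈ᵉ?_) w∈)

      few : inner (remaining U (lo e) (lo f)) E ≤ length F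
      few = begin
        inner R′ E ≤⟨ inner-restrict {U = U} remaining⊆ E ⟩
        inner R′ (innerEdges U E) ≡⟨ cong (inner R′) eq ⟩
        inner R′ (e ∷ f ∷ F)
          ≡⟨ cong length (filter-reject (within? R′) (λ (lo∈ , _) → ∉-remaining {U = U} (inj₁ refl) lo∈)) ⟩
        inner R′ (f ∷ F)
          ≡⟨ cong length (filter-reject (within? R′) (λ (lo∈ , _) → ∉-remaining {U = U} (inj₂ refl) lo∈)) ⟩
        inner R′ F ≤⟨ length-filter (within? R′) F ⟩
        length F ∎
        where
        R′ = remaining U (lo e) (lo f)
        open ≤-Reasoning

    go : ∀ F → innerEdges U E ≡ F → Goal
    go []          eq = from-step (≤-trans (≤-reflexive (cong length eq)) z≤n)
    go (e ∷ [])    eq = from-step (≤-reflexive (cong length eq))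
    -- Only the ends `lo e` and `lo f` are tested: if e and f share just their upper ends, pairing
    -- the lower ends still removes both edges.
    go (e ∷ f ∷ F) eq with lo e ∈ᵉ? f | lo f ∈ᵉ? e | blocked? E (lo e) (lo f)
    ... | yes x∈f | _       | _      = from-cover (lo∈U (here refl)) (two {lo e} (inj₁ refl) (here x∈f))
      where open Split eq
    ... | no _    | yes z∈e | _      = from-cover (lo∈U (there (here refl))) (two z∈e (here (inj₁ refl)))
      where open Split eq
    ... | no x∉f  | no z∉e  | yes bl = from-blocked (find bl)
      where
      open Split eq
      from-blocked : ∃ (λ g → g ∈ E × Joins (lo e) (lo f) g) → Goal
      from-blocked (g , g∈E , x∈g , z∈g) with subst (g ∈_) eq (∈-filter⁺ (within? U) g∈E
        (∈⇒within g (λ x≡z → x∉f (inj₁ x≡z)) (lo∈U (here refl)) (lo∈U (there (here refl))) (x∈g , z∈g)))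
      ... | here refl = contradiction z∈g z∉e
      ... | there g∈ = from-cover (lo∈U (here refl)) (two {lo e} (inj₁ refl) (lose g∈ x∈g))
    ... | no x∉f  | no z∉e  | no ¬bl =
      pair U! (lo∈U (here refl)) (lo∈U (there (here refl))) (λ x≡z → x∉f (inj₁ x≡z)) ¬bl size
        (subst (λ Z → inner (remaining U (lo e) (lo f)) E ≤ length Z ∸ 2) (sym eq) few)
      where open Split eq


  -- Here E may have |U| - 1 edges inside U, one more than `step` admits, and they may all share a
  -- vertex. If u and v are joined in E, that edge misses w, so w lies on at most |U| - 2 of them
  -- and has a free partner.
  freeStep : Unique U → 3 ≤ length U → 1 + inner U E ≤ length U → 2 + r ≤ length U →
    Packing U E 1 r (inner U E)
  freeStep {U@(u ∷ v ∷ w ∷ U′)} {E} {r} U!@((u≢v ∷ u≢w ∷ _) ∷ (v≢w ∷ _) ∷ _) _ enough size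
    with blocked? E u v
  ... | no ¬bl = pair U! (here refl) (there (here refl)) u≢v ¬bl size (inner-mono (remaining⊆ {U = U}) E)
  ... | yes bl =
    let x , x∈U , w≢x , ¬bl = neighbour {E = E} U! w∈U (≤-trans (s≤s few) enough)
    in pair U! w∈U x∈U w≢x ¬bl size (inner-mono (remaining⊆ {U = U}) E)
    where
    w∈U : w ∈ U
    w∈U = there (there (here refl))
    few : degree w (innerEdges U E) < inner U E
    few with g , g∈E , u∈g , v∈g ← find bl =
      filter-notAll (w ∈ᵉ?_) (innerEdges U E) (lose
        (∈-filter⁺ (within? U) g∈E (∈⇒within g u≢v (here refl) (there (here refl)) (u∈g , v∈g)))
        λ w∈g → [ u≢w ∘ sym , v≢w ∘ sym ]′ (endpoints g u∈g v∈g u≢v w∈g))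
  freeStep {_ ∷ []} _ (s≤s ()) _ _
  freeStep {_ ∷ _ ∷ []} _ (s≤s (s≤s ())) _ _

  -- Of the q pairs, k are joined by one edge each and t will be matched by augmentation at two edges each.
  MixedPacking : List (Fin n) → List (Edge n) → (q a : ℕ) → Set
  MixedPacking U E q a = ∃₂ λ k t → k + t ≡ q × k + 2 * t ≤ a × Packing U E k (2 * t) a

  -- The odd vertex gives r = 1 in `packing`, the margin for b = a.
  splitOdd : ∀ {a} → Unique U → 2 * a + 1 ≤ length U → inner U E ≤ a → MixedPacking U E a a
  splitOdd {a = a} U! size few = a , 0 , +-identityʳ a , ≤-reflexive (+-identityʳ a) ,
    weaken z≤n (m∸n≤m a a) (packing a U! size few (≤-reflexive (sym (m+n∸n≡m a 1))))

  -- An augmented pair costs one edge more than a direct one, so the t = a - q spare edges pay for t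
  -- augmentations and q - t pairs are packed. The cases are q ≤ t, where every pair is augmented, q
  -- - t = 1 and q - t ≥ 2.
  splitEven : ∀ {q a} → 2 ≤ a → q ≤ a → Unique U → 2 * q ≤ length U → inner U E ≤ a → MixedPacking U E q a
  splitEven {U} {E} {q} {a} 2≤a q≤a U! size few with t , refl ← m≤n⇒∃[o]m+o≡n q≤a with q ≤? t
  ... | yes q≤t = 0 , q , refl , subst (_≤ q + t) (cong (q +_) (sym (+-identityʳ q))) (+-monoʳ-≤ q q≤t)
                  , noEdges U! size few
  ... | no q≰t with m≤n⇒∃[o]m+o≡n (≰⇒> q≰t)
  -- One direct pair among 2 t + 2 vertices faces up to a = 2 t + 1 edges. It suffices that the pair
  -- is free: the remaining vertices are augmented, however many edges E has among them.
  ...   | zero , refl rewrite +-identityʳ t =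
    1 , t , refl , ≤-reflexive (cong (λ z → suc (t + z)) (+-identityʳ t)) ,
    weaken ≤-refl few (freeStep U! (≤-trans (three 2≤a) size)
      (≤-trans (s≤s few) (≤-trans (≤-reflexive (double t)) size))
      (≤-trans (≤-reflexive (sym (*-suc 2 t))) size))
    where
    double : ∀ t → suc (suc t + t) ≡ 2 * suc t
    double = solve-∀
    three : ∀ {t} → 2 ≤ suc t + t → 3 ≤ 2 * suc t
    three {t} 2≤ rewrite sym (double t) = s≤s 2≤
  ...   | suc s , refl = 2 + s , t , eq₁ s t , ≤-reflexive (eq₂ s t) ,
    weaken ≤-refl (≤-trans (m∸n≤m _ (suc s)) (m∸n≤m _ 2)) (extend first
      (packing (suc s) (rest-unique first) (#rest first) (sparse first) ∸2≤))
    where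
    eq₁ : ∀ s t → 2 + s + t ≡ suc t + suc s
    eq₁ = solve-∀
    eq₂ : ∀ s t → 2 + s + 2 * t ≡ suc t + suc s + t
    eq₂ = solve-∀
    eq₃ : ∀ s t → 2 + (suc t + suc s + t) + s ≡ 2 * (suc t + suc s)
    eq₃ = solve-∀
    eq₄ : ∀ s t → 2 + (2 * suc s + 2 * t) ≡ 2 * (suc t + suc s)
    eq₄ = solve-∀
    first : Packing U E 1 (2 * suc s + 2 * t) (suc t + suc s + t ∸ 2)
    first = weaken ≤-refl (∸-monoˡ-≤ 2 few) (step₂ U!
      (≤-trans (+-monoʳ-≤ 2 few) (≤-trans (m≤m+n _ s) (≤-trans (≤-reflexive (eq₃ s t)) size)))
      (≤-trans (≤-reflexive (eq₄ s t)) size))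
    -- An equality, so `packing` would be short by one had `first` met only one edge.
    ∸2≤ : suc t + suc s + t ∸ 2 ≤ suc s + 2 * t ∸ 1
    ∸2≤ = ≤-reflexive (cong (_∸ 2) (sym (eq₂ s t)))

-- Augmentation

module _ {n : ℕ} where

  open Edge
  private variable
    u v w : Fin n
    e f : Edge n
    U W : List (Fin n)
    E M : List (Edge n)

  Crosses : List (Fin n) → Edge n → Edge n → Set
  Crosses W f e = Any (_∈ᵉ e) W × (lo f ∈ᵉ e ⊎ hi f ∈ᵉ e)

  crosses? : ∀ W f → Decidable (Crosses W f)
  crosses? W f e = any? (_∈ᵉ? e) W ×-dec (lo f ∈ᵉ? e ⊎-dec hi f ∈ᵉ? e)

  -- At most one edge of E runs between W and f, put in a form that is indifferent to repetitions in
  -- the list E.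
  Quiet : List (Fin n) → List (Edge n) → Edge n → Set
  Quiet W E f = ∀ {w w′ z z′} → w ∈ W → w′ ∈ W → z ∈ᵉ f → z′ ∈ᵉ f →
    Blocked E w z → Blocked E w′ z′ → w ≡ w′ × z ≡ z′

  -- An edge of E with one end in W has at most its other end on M, so it crosses to at most one
  -- edge of M. With fewer than 2 |M| edges in E, some f receives at most one.
  quietEdge : AllPairs Disjoint M → Avoids W M → length E < 2 * length M →
    ∃ λ f → f ∈ M × Quiet W E f
  quietEdge {M} {W} {E} M-disj W-avoids short =
    let f , f∈M , few = pigeonhole (crosses? W) 2 {M} {E} (matching-unique M-disj)
          (λ {e} _ f∈ f′∈ → func {e} f∈ f′∈) short
    in f , f∈M , quiet f∈M few
    where
    ∈f : ∀ {f e} → lo f ∈ᵉ e ⊎ hi f ∈ᵉ e → ∃ λ z → z ∈ᵉ f × z ∈ᵉ e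
    ∈f (inj₁ lo∈) = _ , inj₁ refl , lo∈
    ∈f (inj₂ hi∈) = _ , inj₂ refl , hi∈

    func : ∀ {e f f′} → f ∈ M → f′ ∈ M → Crosses W f e → Crosses W f′ e → f ≡ f′
    func {e} {f} {f′} f∈ f′∈ (w∈ , c) (_ , c′)
      with w , w∈W , w∈e ← find w∈ | z , z∈f , z∈e ← ∈f {f} {e} c | z′ , z′∈f′ , z′∈e ← ∈f {f′} {e} c′
      with endpoints e w∈e z∈e (λ { refl → W-avoids w∈W f∈ z∈f }) z′∈e
    ... | inj₁ refl = contradiction z′∈f′ (W-avoids w∈W f′∈)
    ... | inj₂ refl = matching-≡ M-disj f∈ f′∈ z∈f z′∈f′

    crossing : ∀ {f w z e} → w ∈ W → z ∈ᵉ f → Joins w z e → Crosses W f e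
    crossing w∈W (inj₁ refl) (w∈e , z∈e) = lose w∈W w∈e , inj₁ z∈e
    crossing w∈W (inj₂ refl) (w∈e , z∈e) = lose w∈W w∈e , inj₂ z∈e

    quiet : ∀ {f} → f ∈ M → count (crosses? W f) E < 2 → Quiet W E f
    quiet {f} f∈M few {w} {w′} {z} {z′} w∈ w′∈ z∈ z′∈ bl bl′
      with e , e∈E , w∈e , z∈e ← find bl | e′ , e′∈E , w′∈e , z′∈e ← find bl′
      with refl ← count<2⇒≡ (crosses? W f) few e∈E (crossing {f} {e = e} w∈ z∈ (w∈e , z∈e))
                                               e′∈E (crossing {f} {e = e′} w′∈ z′∈ (w′∈e , z′∈e))
      with endpoints e w∈e z∈e (λ { refl → W-avoids w∈ f∈M z∈ }) w′∈e
         | endpoints e w∈e z∈e (λ { refl → W-avoids w∈ f∈M z∈ }) z′∈e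
    ... | inj₂ refl | _         = contradiction z∈ (W-avoids w′∈ f∈M)
    ... | inj₁ _    | inj₁ refl = contradiction z′∈ (W-avoids w∈ f∈M)
    ... | inj₁ refl | inj₂ refl = refl , refl

  orient : ∀ f → Quiet W E f → u ∈ W → v ∈ W → u ≢ v →
    ∃₂ λ x y → x ∈ᵉ f × y ∈ᵉ f × x ≢ y × ¬ Blocked E u x × ¬ Blocked E v y
  orient {E = E} {u} {v} f quiet u∈ v∈ u≢v with blocked? E u (lo f) | blocked? E v (hi f)
  ... | no ¬bl | no ¬bl′ = lo f , hi f , inj₁ refl , inj₂ refl , lo≢hi f , ¬bl , ¬bl′
  ... | yes bl | _       = hi f , lo f , inj₂ refl , inj₁ refl , lo≢hi f ∘ sym ,
    (λ bl′ → lo≢hi f (proj₂ (quiet u∈ u∈ (inj₁ refl) (inj₂ refl) bl bl′))) ,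
    (λ bl′ → u≢v (proj₁ (quiet u∈ v∈ (inj₁ refl) (inj₁ refl) bl bl′)))
  ... | no _   | yes bl  = hi f , lo f , inj₂ refl , inj₁ refl , lo≢hi f ∘ sym ,
    (λ bl′ → u≢v (proj₁ (quiet u∈ v∈ (inj₂ refl) (inj₂ refl) bl′ bl))) ,
    (λ bl′ → lo≢hi f (proj₂ (quiet v∈ v∈ (inj₁ refl) (inj₂ refl) bl′ bl)))

  -- The edges `new` are to be claimed, `old` is the part of M that survives. By `touches` the new
  -- edges are not already Maker's; `span` keeps augmentations through different edges of M
  -- disjoint.
  record Augmentation (U : List (Fin n)) (E M : List (Edge n)) (t : ℕ) : Set where
    field
      new old  : List (Edge n)
      #new     : length new ≡ 2 * t
      #all     : length (new ++ old) ≡ t + length M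
      disjoint : AllPairs Disjoint (new ++ old)
      old⊆M    : old ⊆ M
      free     : ∀ {d} → d ∈ new → d ∉ E
      touches  : ∀ {d} → d ∈ new → Any (_∈ᵉ d) U
      span     : ∀ {d v} → d ∈ new ++ old → v ∈ᵉ d → v ∈ U ⊎ Any (v ∈ᵉ_) M

  open Augmentation

  -- Each augmentation uses up one edge f of M, so both sides of the last hypothesis drop by two and
  -- it persists. While t is positive it also yields the strict inequality that `quietEdge` asks
  -- for.
  augment : ∀ t {U M} → Unique U → 2 * t ≤ length U → AllPairs Disjoint M → Avoids U M →
    length E + 2 * t ≤ 2 * length M → Augmentation U E M t
  augment zero {M = M} _ _ M-disj _ _ = record
    { new = [] ; old = M ; #new = refl ; #all = refl ; disjoint = M-disj ; old⊆M = id
    ; free = λ () ; touches = λ () ; span = λ d∈M v∈d → inj₂ (lose d∈M v∈d) }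
  augment (suc t) {[]} _ () _ _ _
  augment (suc t) {_ ∷ []} _ size _ _ _ =
    contradiction (≤-trans (≤-reflexive (sym (*-suc 2 t))) size) λ { (s≤s ()) }
  augment {E} (suc t) {u ∷ v ∷ U} {M} ((u≢v ∷ u≢U) ∷ v≢U ∷ U!) size M-disj avoids enough
    with f , f∈M , quiet ← quietEdge {W = u ∷ v ∷ []} {E = E} M-disj
           (λ { (here refl) → avoids (here refl) ; (there (here refl)) → avoids (there (here refl)) })
           (≤-trans (≤-trans (s≤s (m≤m+n _ _)) (≤-reflexive (sym (+-suc _ _)))) enough)
    with x , y , x∈f , y∈f , x≢y , ¬bl , ¬bl′ ← orient f quiet (here refl) (there (here refl)) u≢v
    with d , u∈d , x∈d ← joining {u = u} {x} (λ { refl → avoids (here refl) f∈M x∈f })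
       | d′ , v∈d′ , y∈d′ ← joining {u = v} {y} (λ { refl → avoids (there (here refl)) f∈M y∈f })
    = record
    { new = d ∷ d′ ∷ new rec
    ; old = old rec
    ; #new = trans (cong (2 +_) (#new rec)) (sym (*-suc 2 t))
    ; #all = trans (cong (2 +_) (#all rec))
        (trans (cong suc (sym (+-suc t _))) (cong (suc t +_) (sym #M)))
    ; disjoint = (d-d′ ∷ All.tabulate (λ g∈ z (z∈d , z∈g) → sep (d-own z∈d) (span rec {v = z} g∈ z∈g)))
               ∷ All.tabulate (λ g∈ z (z∈d′ , z∈g) → sep (d′-own z∈d′) (span rec {v = z} g∈ z∈g))
               ∷ disjoint rec
    ; old⊆M = proj₁ ∘ ∈-remove⁻ _≟ᵉ_ ∘ old⊆M rec
    ; free = λ { (here refl) → ¬blocked⇒∉ ¬bl u∈d x∈d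
               ; (there (here refl)) → ¬blocked⇒∉ ¬bl′ v∈d′ y∈d′
               ; (there (there g∈)) → free rec g∈ }
    ; touches = λ { (here refl) → here u∈d
                  ; (there (here refl)) → there (here v∈d′)
                  ; (there (there g∈)) → there (there (touches rec g∈)) }
    ; span = λ { (here refl) z∈d → own-span (d-own z∈d)
               ; (there (here refl)) z∈d′ → own-span (d′-own z∈d′)
               ; {v = z} (there (there g∈)) z∈g → rec-span (span rec {v = z} g∈ z∈g) }
    }
    where
    M′ = remove _≟ᵉ_ f M

    #M : length M ≡ suc (length M′)
    #M = length-remove-∈ _≟ᵉ_ (matching-unique M-disj) f∈M

    rec : Augmentation U E M′ t
    rec = augment t U! (≤-pred (≤-pred (≤-trans (≤-reflexive (sym (*-suc 2 t))) size)))
      (AllPairs.filter⁺ _ M-disj) (λ z∈ g∈ → avoids (there (there z∈)) (proj₁ (∈-remove⁻ _≟ᵉ_ g∈)))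
      (+-cancelˡ-≤ 2 _ _ (begin
        2 + (length E + 2 * t) ≡⟨ shuffle (length E) t ⟩
        length E + 2 * suc t   ≤⟨ enough ⟩
        2 * length M           ≡⟨ cong (2 *_) #M ⟩
        2 * suc (length M′)    ≡⟨ *-suc 2 (length M′) ⟩
        2 + 2 * length M′      ∎))
      where
      open ≤-Reasoning
      shuffle : ∀ m t → 2 + (m + 2 * t) ≡ m + 2 * suc t
      shuffle = solve-∀

    Own : Fin n → Set
    Own z = z ∈ u ∷ v ∷ [] ⊎ z ∈ᵉ f

    d-own : ∀ {z} → z ∈ᵉ d → Own z
    d-own z∈d with endpoints d u∈d x∈d (λ { refl → avoids (here refl) f∈M x∈f }) z∈d
    ... | inj₁ refl = inj₁ (here refl)
    ... | inj₂ refl = inj₂ x∈f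

    d′-own : ∀ {z} → z ∈ᵉ d′ → Own z
    d′-own z∈d′ with endpoints d′ v∈d′ y∈d′ (λ { refl → avoids (there (here refl)) f∈M y∈f }) z∈d′
    ... | inj₁ refl = inj₁ (there (here refl))
    ... | inj₂ refl = inj₂ y∈f

    d-d′ : Disjoint d d′
    d-d′ z (z∈d , z∈d′)
      with endpoints d u∈d x∈d (λ { refl → avoids (here refl) f∈M x∈f }) z∈d
         | endpoints d′ v∈d′ y∈d′ (λ { refl → avoids (there (here refl)) f∈M y∈f }) z∈d′
    ... | inj₁ refl | inj₁ refl = u≢v refl
    ... | inj₁ refl | inj₂ refl = avoids (here refl) f∈M y∈f
    ... | inj₂ refl | inj₁ refl = avoids (there (here refl)) f∈M x∈f
    ... | inj₂ refl | inj₂ refl = x≢y refl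

    sep : ∀ {z} → Own z → ¬ (z ∈ U ⊎ Any (z ∈ᵉ_) M′)
    sep (inj₁ (here refl))         (inj₁ z∈U) = All.lookup u≢U z∈U refl
    sep (inj₁ (there (here refl))) (inj₁ z∈U) = All.lookup v≢U z∈U refl
    sep (inj₂ z∈f)                 (inj₁ z∈U) = avoids (there (there z∈U)) f∈M z∈f
    sep own (inj₂ z∈M′)
      with g , g∈M′ , z∈g ← find z∈M′
      with g∈M , g≢f ← ∈-remove⁻ _≟ᵉ_ {xs = M} g∈M′
      with own
    ... | inj₁ (here refl)         = avoids (here refl) g∈M z∈g
    ... | inj₁ (there (here refl)) = avoids (there (here refl)) g∈M z∈g
    ... | inj₂ z∈f                 = g≢f (matching-≡ M-disj g∈M f∈M z∈g z∈f)

    own-span : ∀ {z} → Own z → z ∈ u ∷ v ∷ U ⊎ Any (z ∈ᵉ_) M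
    own-span (inj₁ (here refl))         = inj₁ (here refl)
    own-span (inj₁ (there (here refl))) = inj₁ (there (here refl))
    own-span (inj₂ z∈f)                 = inj₂ (lose f∈M z∈f)

    rec-span : ∀ {z} → z ∈ U ⊎ Any (z ∈ᵉ_) M′ → z ∈ u ∷ v ∷ U ⊎ Any (z ∈ᵉ_) M
    rec-span (inj₁ z∈U)  = inj₁ (there (there z∈U))
    rec-span (inj₂ z∈M′) with g , g∈M′ , z∈g ← find z∈M′ =
      inj₂ (lose (proj₁ (∈-remove⁻ _≟ᵉ_ {xs = M} g∈M′)) z∈g)

-- Strategies from winning positions

module Games {X : Set} (_≟ˣ_ : DecidableEquality X) (all : List X) (∈-all : ∀ x → x ∈ all)
             (𝓕 : Pred (List X) 0ℓ) (a : ℕ) where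

  open MakerBreaker X 𝓕 a
  open import Data.List.Membership.DecPropositional _≟ˣ_ using (_∈?_)

  private variable
    c d : List X

  exactMove : Unique d → (∀ {x} → x ∈ d → x ∉ c) → length d ≡ a → Move c
  exactMove {d} d! fresh size = record
    { picks = d ; distinct = d! ; unclaimed = All.tabulate fresh ; size = inj₁ size }

  -- A legal move has exactly a picks unless the board runs out, so a shorter plan is filled up with
  -- arbitrary unclaimed elements. These are deduplicated because `all` may list an element twice.
  completeMove : ∀ d → Unique d → (∀ {x} → x ∈ d → x ∉ c) → length d ≤ a → Σ[ m ∈ Move c ] d ⊆ picks m
  completeMove {c} d d! fresh d≤a = record
    { picks = d ++ extra
    ; distinct = Unique.++⁺ d! (Unique.take⁺ (a ∸ length d) (DecUnique.deduplicate-! _≟ˣ_ pool))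
        (λ (x∈d , x∈extra) → proj₁ (proj₂ (pool⁻ (take⊆ (a ∸ length d) x∈extra))) x∈d)
    ; unclaimed = All.++⁺ (All.tabulate fresh)
        (All.tabulate λ x∈extra → proj₂ (proj₂ (pool⁻ (take⊆ (a ∸ length d) x∈extra))))
    ; size = size′
    } , ∈-++⁺ˡ
    where
    Fresh : X → Set
    Fresh x = x ∉ d × x ∉ c
    fresh? : Decidable Fresh
    fresh? x = ¬? (x ∈? d) ×-dec ¬? (x ∈? c)
    pool = filter fresh? all
    choices = deduplicate _≟ˣ_ pool
    extra = take (a ∸ length d) choices

    pool⁻ : ∀ {x} → x ∈ choices → x ∈ all × Fresh x
    pool⁻ = ∈-filter⁻ fresh? ∘ ∈-deduplicate⁻ _≟ˣ_ pool

    take⊆ : ∀ k {xs : List X} → take k xs ⊆ xs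
    take⊆ (suc k) {_ ∷ _} (here refl) = here refl
    take⊆ (suc k) {_ ∷ _} (there x∈)  = there (take⊆ k x∈)

    open ≤-Reasoning
    size′ : length (d ++ extra) ≡ a ⊎ (length (d ++ extra) < a × (∀ x → x ∈ (d ++ extra) ++ c))
    size′ with a ∸ length d ≤? length choices
    ... | yes enough = inj₁ (begin-equality
      length (d ++ extra)                      ≡⟨ length-++ d ⟩
      length d + length extra                  ≡⟨ cong (length d +_) (length-take _ choices) ⟩
      length d + (a ∸ length d) ⊓ length choices ≡⟨ cong (length d +_) (m≤n⇒m⊓n≡m enough) ⟩
      length d + (a ∸ length d)                ≡⟨ m+[n∸m]≡n d≤a ⟩
      a                                        ∎)
    ... | no few rewrite take-all (a ∸ length d) choices (<⇒≤ (≰⇒> few)) = inj₂ ((begin-strict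
      length (d ++ choices)                    ≡⟨ length-++ d ⟩
      length d + length choices                <⟨ +-monoʳ-< (length d) (≰⇒> few) ⟩
      length d + (a ∸ length d)                ≡⟨ m+[n∸m]≡n d≤a ⟩
      a                                        ∎) , everything)
      where
      everything : ∀ x → x ∈ (d ++ choices) ++ c
      everything x with x ∈? d | x ∈? c
      ... | yes x∈d | _       = ∈-++⁺ˡ (∈-++⁺ˡ x∈d)
      ... | no _    | yes x∈c = ∈-++⁺ʳ (d ++ choices) x∈c
      ... | no x∉d  | no x∉c  =
        ∈-++⁺ˡ (∈-++⁺ʳ d (∈-deduplicate⁺ _≟ˣ_ (∈-filter⁺ fresh? (∈-all x) (x∉d , x∉c))))

  anyMove : Move c
  anyMove = proj₁ (completeMove [] [] (λ ()) z≤n)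

  size≤ : (m : Move c) → length (picks m) ≤ a
  size≤ m = [ ≤-reflexive , <⇒≤ ∘ proj₁ ]′ (size m)

  breakerClaimed : History → List X
  breakerClaimed = concatMap proj₁

  claimed⁻ : ∀ h {x} → x ∈ claimed h → x ∈ makerClaimed h ⊎ x ∈ breakerClaimed h
  claimed⁻ ((b , m) ∷ h) x∈ with ∈-++⁻ (m ++ b) x∈
  ... | inj₂ x∈h = [ inj₁ ∘ ∈-++⁺ʳ m , inj₂ ∘ ∈-++⁺ʳ b ]′ (claimed⁻ h x∈h)
  ... | inj₁ x∈  = [ inj₁ ∘ ∈-++⁺ˡ , inj₂ ∘ ∈-++⁺ˡ ]′ (∈-++⁻ m x∈)

  maker⊆claimed : ∀ h → makerClaimed h ⊆ claimed h
  maker⊆claimed ((b , m) ∷ h) x∈ =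
    [ ∈-++⁺ˡ ∘ ∈-++⁺ˡ , ∈-++⁺ʳ (m ++ b) ∘ maker⊆claimed h ]′ (∈-++⁻ m x∈)

  #makerClaimed : ∀ β μ s → length (makerClaimed (play β μ s)) ≤ s * a
  #makerClaimed β μ zero = z≤n
  #makerClaimed β μ (suc s) = ≤-trans (≤-reflexive (length-++ (picks (μ _ _))))
    (+-mono-≤ (size≤ (μ _ _)) (#makerClaimed β μ s))

  -- Maker can win within k further moves from h.  Breaker is not held to legal
  -- moves here, only to at most a picks.
  Winning : ℕ → History → Set
  Winning zero    h = MakerHasWon h
  Winning (suc k) h = ∀ b → length b ≤ a →
    Σ[ m ∈ Move (b ++ claimed h) ] Winning k ((b , picks m) ∷ h)

  private
    -- A strategy must answer every history, including those it never leads to; these become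
    -- `nothing` and are answered by `anyMove`.
    Position : History → Set
    Position h = Maybe (∃ λ k → Winning k h)

  -- A witness of `Winning` continues only after its own reply, so the recorded m has to be compared
  -- with that reply before the witness can be passed on.
  advance : ∀ {h} b m → ∃ (λ k → Winning k h) → Position ((b , m) ∷ h)
  advance b m (zero , _) = nothing
  advance b m (suc k , w) with length b ≤? a
  ... | no _ = nothing
  ... | yes b≤a with ≡-dec _≟ˣ_ (picks (proj₁ (w b b≤a))) m
  ...   | no _ = nothing
  ...   | yes refl = just (k , proj₂ (w b b≤a))

  replay : ∀ {t} → Winning t [] → ∀ h → Position h
  replay w []            = just (_ , w)
  replay w ((b , m) ∷ h) = replay w h >>= advance b m

  respond : ∀ {h} → Position h → ∀ b → Move (b ++ claimed h)
  respond (just (suc k , w)) b with length b ≤? a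
  ... | yes b≤a = proj₁ (w b b≤a)
  ... | no _    = anyMove
  respond (just (zero , _)) b = anyMove
  respond nothing           b = anyMove

  advance-respond : ∀ {h k} (w : Winning (suc k) h) b → length b ≤ a →
    ∃ λ w′ → advance b (picks (respond (just (suc k , w)) b)) (suc k , w) ≡ just (k , w′)
  advance-respond w b b≤a with length b ≤? a
  ... | no b≰a = contradiction b≤a b≰a
  ... | yes b≤a′ with ≡-dec _≟ˣ_ (picks (proj₁ (w b b≤a′))) (picks (proj₁ (w b b≤a′)))
  ...   | yes refl = _ , refl
  ...   | no ≢     = contradiction refl ≢

  winning⇒winsWithin : ∀ {t} → Winning t [] → MakerWinsWithin t
  winning⇒winsWithin {t} w₀ = μ , λ β → proj₁ (follows β t 0 (+-identityʳ t))
    where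
    μ : MakerStrategy
    μ h = respond (replay w₀ h)
    follows : ∀ β j k → j + k ≡ t →
      ∃ λ (w : Winning k (play β μ j)) → replay w₀ (play β μ j) ≡ just (k , w)
    follows β zero k refl = w₀ , refl
    follows β (suc j) k eq with w , eq′ ← follows β j (suc k) (trans (+-suc j k) eq)
      rewrite eq′ = advance-respond w (picks (β _)) (size≤ (β _))

-- Lower bounds

module _ {n : ℕ} where

  open Edge
  private variable
    M F : List (Edge n)
    v : Fin n

  ends : List (Edge n) → List (Fin n)
  ends = concatMap λ e → lo e ∷ hi e ∷ []

  ∈-ends⁻ : ∀ M → v ∈ ends M → Any (v ∈ᵉ_) M
  ∈-ends⁻ (e ∷ M) (here refl)         = here (inj₁ refl)
  ∈-ends⁻ (e ∷ M) (there (here refl)) = here (inj₂ refl)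
  ∈-ends⁻ (e ∷ M) (there (there v∈))  = there (∈-ends⁻ M v∈)

  ends-unique : AllPairs Disjoint M → Unique (ends M)
  ends-unique [] = []
  ends-unique {e ∷ M} (d ∷ ds) =
    (lo≢hi e ∷ All.tabulate (outside (inj₁ refl))) ∷ All.tabulate (outside (inj₂ refl)) ∷ ends-unique ds
    where
    outside : ∀ {v w} → v ∈ᵉ e → w ∈ ends M → v ≢ w
    outside {v} v∈e w∈ refl with f , f∈M , v∈f ← find (∈-ends⁻ M w∈) = All.lookup d f∈M v (v∈e , v∈f)

  #ends : ∀ M → length (ends M) ≡ 2 * length M
  #ends []      = refl
  #ends (e ∷ M) = trans (cong (2 +_) (#ends M)) (sym (*-suc 2 (length M)))

  -- The 2 |M| ends of a matching are distinct, so they exhaust the vertices.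
  perfect-covers : AllPairs Disjoint M → n ≤ 2 * length M → ∀ v → Any (v ∈ᵉ_) M
  perfect-covers {M} disj n≤ v = ∈-ends⁻ M (⊆-reverse _≟ᶠ_ (ends-unique disj) (λ {w} _ → ∈-allFin w)
    (subst₂ _≤_ (sym (length-tabulate id)) (sym (#ends M)) n≤) (∈-allFin v))

  module _ (a : ℕ) where

    open MakerBreaker (Edge n) (PerfectMatching n) a
    open Games _≟ᵉ_ allEdges ∈-allEdges (PerfectMatching n) a

    edges≤claims : ∀ s → MakerWinsWithin s → ⌊ n /2⌋ ≤ s * a
    edges≤claims s (μ , wins) with F , (#F , disj) , F⊆ ← wins (λ _ → anyMove) =
      subst (_≤ s * a) #F (≤-trans (length-⊆ (matching-unique disj) F⊆) (#makerClaimed _ μ s))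

  module _ where

    open MakerBreaker (Edge n) (PerfectMatching n) 1
    open Games _≟ᵉ_ allEdges ∈-allEdges (PerfectMatching n) 1

    private
      Threat : History → Edge n → Set
      Threat h e = e ∉ claimed h × ¬ Any (lo e ∈ᵉ_) (makerClaimed h) × ¬ Any (hi e ∈ᵉ_) (makerClaimed h)

      open import Data.List.Membership.DecPropositional (_≟ᵉ_ {n}) using (_∈?_)

      threat? : ∀ h → Decidable (Threat h)
      threat? h e = ¬? (e ∈? claimed h)
        ×-dec ¬? (any? (lo e ∈ᵉ?_) (makerClaimed h)) ×-dec ¬? (any? (hi e ∈ᵉ?_) (makerClaimed h))

      -- Which threat is taken matters only before Maker's last move: if she has wasted no edge, two
      -- vertices are uncovered and at most one threat exists.
      block : BreakerStrategy
      block h with any? (threat? h) allEdges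
      ... | no _ = anyMove
      ... | yes found with e , _ , e∉ , _ ← find found =
        proj₁ (completeMove (e ∷ []) ([] ∷ []) (λ { (here refl) → e∉ }) ≤-refl)

      block-threat : ∀ h {e} → Threat h e → ∃ λ f → Threat h f × f ∈ picks (block h)
      block-threat h {e} thr with any? (threat? h) allEdges
      ... | no none = contradiction (lose (∈-allEdges e) thr) none
      ... | yes found with f , _ , thr′@(f∉ , _) ← find found =
        f , thr′ , proj₂ (completeMove (f ∷ []) ([] ∷ []) (λ { (here refl) → f∉ }) ≤-refl) (here refl)

    -- A win with N + 1 edges makes Maker's edges exactly the matching F. Before the last edge e
    -- only the ends of e are uncovered, so the threat f taken by `block` is e itself.
    no-perfect-play : ∀ N → ⌊ n /2⌋ ≡ suc N → n ≤ 2 * suc N → ¬ MakerWinsWithin (suc N)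
    no-perfect-play N half n≤ (μ , wins)
      with F , (#F , disj) , F⊆ ← wins block =
        last (picks move) (size≤ move) F⊆ (All.lookup (unclaimed move))
      where
      h = play block μ N
      B = picks (block h)
      C = makerClaimed h
      move = μ h B

      #C : length C ≤ N
      #C = subst (length C ≤_) (*-identityʳ N) (#makerClaimed block μ N)

      last : ∀ m → length m ≤ 1 → F ⊆ m ++ C → (∀ {e} → e ∈ m → e ∉ B ++ claimed h) → ⊥
      last [] _ F⊆ _ = n≮n N (≤-trans (≤-reflexive (sym (trans #F half)))
        (≤-trans (length-⊆ (matching-unique disj) F⊆) #C))
      last (e ∷ []) _ F⊆ legal = e∉B (subst (_∈ B) f≡e f∈B)
        where
        e∉ = legal (here refl)
        e∉B = e∉ ∘ ∈-++⁺ˡ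
        e∉h = e∉ ∘ ∈-++⁺ʳ B

        ⊆F : e ∷ C ⊆ F
        ⊆F = ⊆-reverse _≟ᵉ_ (matching-unique disj) F⊆
          (≤-trans (s≤s #C) (≤-reflexive (sym (trans #F half))))

        untouched : ∀ {v} → v ∈ᵉ e → ¬ Any (v ∈ᵉ_) C
        untouched v∈e v∈C with g , g∈C , v∈g ← find v∈C
          with refl ← matching-≡ disj (⊆F (here refl)) (⊆F (there g∈C)) v∈e v∈g =
            e∉h (maker⊆claimed h g∈C)

        threatened = block-threat h {e} (e∉h , untouched (inj₁ refl) , untouched (inj₂ refl))
        f = proj₁ threatened
        f-threat = proj₁ (proj₂ threatened)
        f∈B = proj₂ (proj₂ threatened)

        at-e : ∀ {v} → ¬ Any (v ∈ᵉ_) C → v ∈ᵉ e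
        at-e {v} v∉C with g , g∈F , v∈g ← find (perfect-covers disj
          (≤-trans n≤ (≤-reflexive (cong (2 *_) (sym (trans #F half))))) v) with F⊆ g∈F
        ... | here refl = v∈g
        ... | there g∈C = contradiction (lose g∈C v∈g) v∉C

        f≡e : f ≡ e
        f≡e = edge-unique f e (lo≢hi f) (inj₁ refl) (inj₂ refl)
          (at-e (proj₁ (proj₂ f-threat))) (at-e (proj₂ (proj₂ f-threat)))
      last (_ ∷ _ ∷ _) (s≤s ()) _ _

-- Upper bounds

module _ {n a : ℕ} where

  open Edge
  open MakerBreaker (Edge n) (PerfectMatching n) a
  open Games _≟ᵉ_ allEdges ∈-allEdges (PerfectMatching n) a

  -- By `clean` the next move faces only Breaker's new picks inside U; `#breaker` bounds all his
  -- edges, as augmentation will require.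
  record Clean (c : ℕ) (h : History) : Set where
    field
      U        : List (Fin n)
      U-unique : Unique U
      matching : AllPairs Disjoint (makerClaimed h)
      avoids   : Avoids U (makerClaimed h)
      #maker   : length (makerClaimed h) ≡ c * a
      #U       : n ≤ 2 * (c * a) + length U
      clean    : inner U (breakerClaimed h) ≡ 0
      #breaker : length (breakerClaimed h) ≤ c * a

  open Clean

  clean-start : Clean 0 []
  clean-start = record
    { U = allFin n ; U-unique = Unique.allFin⁺ n ; matching = [] ; avoids = λ _ ()
    ; #maker = refl ; #U = ≤-reflexive (sym (length-tabulate id)) ; clean = refl ; #breaker = z≤n }

  module _ {c h} (I : Clean c h) (b : List (Edge n)) (b≤a : length b ≤ a) where

    inner-round : inner (U I) (b ++ breakerClaimed h) ≤ a
    inner-round = begin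
      inner (U I) (b ++ breakerClaimed h)               ≡⟨ count-++ (within? (U I)) b _ ⟩
      inner (U I) b + inner (U I) (breakerClaimed h)    ≡⟨ cong (inner (U I) b +_) (clean I) ⟩
      inner (U I) b + 0                                 ≡⟨ +-identityʳ _ ⟩
      inner (U I) b                                     ≤⟨ length-filter (within? (U I)) b ⟩
      length b                                          ≤⟨ b≤a ⟩
      a                                                 ∎
      where open ≤-Reasoning

    #breaker′ : length (b ++ breakerClaimed h) ≤ suc c * a
    #breaker′ = ≤-trans (≤-reflexive (length-++ b)) (+-mono-≤ b≤a (#breaker I))

    -- Maker's edges avoid U, so only Breaker can have taken an edge that meets U.
    fresh : ∀ {d} → d ∉ b ++ breakerClaimed h → Any (_∈ᵉ d) (U I) → d ∉ b ++ claimed h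
    fresh d∉ touches d∈ with u , u∈U , u∈d ← find touches with ∈-++⁻ b d∈
    ... | inj₁ d∈b = d∉ (∈-++⁺ˡ d∈b)
    ... | inj₂ d∈h with claimed⁻ h d∈h
    ...   | inj₁ d∈M = avoids I u∈U d∈M u∈d
    ...   | inj₂ d∈B = d∉ (∈-++⁺ʳ b d∈B)

    module _ {k r s} (P : Packing (U I) (b ++ breakerClaimed h) k r s) where

      open Packing P

      packing-fresh : ∀ {d} → d ∈ edges → d ∉ b ++ claimed h
      packing-fresh {d} d∈ = fresh (free d∈) (lose (inside d∈ (inj₁ refl)) (inj₁ refl))

      packing-matching : AllPairs Disjoint (edges ++ makerClaimed h)
      packing-matching = AllPairs.++⁺ disjoint (matching I)
        (All.tabulate λ d∈ → All.tabulate λ e∈ v (v∈d , v∈e) → avoids I (inside d∈ v∈d) e∈ v∈e)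

      rest-avoids-all : Avoids rest (edges ++ makerClaimed h)
      rest-avoids-all {e = e} v∈ e∈ v∈e =
        [ (λ e∈P → rest-avoids {e = e} v∈ e∈P v∈e) , (λ e∈M → avoids I (rest⊆U v∈) e∈M v∈e) ]′
          (∈-++⁻ edges e∈)

  -- The strict bound leaves r ≥ 1 vertices after the move, the margin with which a disjoint edges
  -- meet all of Breaker's at most a edges inside U.
  cleaningRound : ∀ {c h k} → Clean c h → 2 * (suc c * a) < n →
    (∀ {h′} → Clean (suc c) h′ → Winning k h′) → Winning (suc k) h
  cleaningRound {c} {h} I bound win b b≤a =
    exactMove (matching-unique disjoint) (packing-fresh I b b≤a P) #edges , win I′
    where
    room : 2 * a + 1 ≤ length (U I)
    room = +-cancelˡ-≤ (2 * (c * a)) _ _ (begin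
      2 * (c * a) + (2 * a + 1)   ≡⟨ eq (c * a) a ⟩
      suc (2 * (suc c * a))       ≤⟨ bound ⟩
      n                           ≤⟨ #U I ⟩
      2 * (c * a) + length (U I)  ∎)
      where
      open ≤-Reasoning
      eq : ∀ ca a → 2 * ca + (2 * a + 1) ≡ suc (2 * (a + ca))
      eq = solve-∀
    r = length (U I) ∸ 2 * a
    2a≤ : 2 * a ≤ length (U I)
    2a≤ = ≤-trans (m≤m+n _ 1) room
    1≤r : 1 ≤ r
    1≤r = ≤-trans (≤-reflexive (sym (m+n∸m≡n (2 * a) 1))) (∸-monoˡ-≤ (2 * a) room)
    P : Packing (U I) (b ++ breakerClaimed h) a r (a ∸ a)
    P = packing a (U-unique I) (≤-reflexive (m+[n∸m]≡n 2a≤)) (inner-round I b b≤a)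
      (≤-trans (≤-reflexive (sym (m+n∸n≡m a 1))) (∸-monoˡ-≤ 1 (+-monoʳ-≤ a 1≤r)))
    open Packing P
    I′ : Clean (suc c) ((b , edges) ∷ h)
    I′ = record
      { U = rest
      ; U-unique = rest-unique
      ; matching = packing-matching I b b≤a P
      ; avoids = rest-avoids-all I b b≤a P
      ; #maker = trans (length-++ edges) (cong₂ _+_ #edges (#maker I))
      ; #U = begin
          n ≤⟨ #U I ⟩
          2 * (c * a) + length (U I) ≡⟨ cong (2 * (c * a) +_) (m+[n∸m]≡n 2a≤) ⟨
          2 * (c * a) + (2 * a + r) ≡⟨ eq (c * a) a r ⟩
          2 * (suc c * a) + r ≤⟨ +-monoʳ-≤ (2 * (suc c * a)) #rest ⟩
          2 * (suc c * a) + length rest ∎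
      ; clean = n≤0⇒n≡0 (≤-trans sparse (≤-reflexive (n∸n≡0 a)))
      ; #breaker = #breaker′ I b b≤a
      }
      where
      open ≤-Reasoning
      eq : ∀ ca a r → 2 * ca + (2 * a + r) ≡ 2 * (a + ca) + r
      eq = solve-∀

  cleaningPhase : ∀ i {c h k} → Clean c h → 2 * ((i + c) * a) < n →
    (∀ {h′} → Clean (i + c) h′ → Winning k h′) → Winning (i + k) h
  cleaningPhase zero I bound win = win I
  cleaningPhase (suc i) {c} {k = k} I bound win = cleaningRound I
    (≤-<-trans (*-monoʳ-≤ 2 (*-monoˡ-≤ a (s≤s (m≤n+m c i)))) bound)
    λ I′ → cleaningPhase i I′ (subst (λ z → 2 * (z * a) < n) (sym (+-suc i c)) bound)
      λ {h′} I″ → win (subst (λ z → Clean z h′) (+-suc i c) I″)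

  finalRound : ∀ {c h q} (I : Clean c h) → (∀ {E} → inner (U I) E ≤ a → MixedPacking (U I) E q a) →
    q + c * a ≡ ⌊ n /2⌋ → suc c * a + a ≤ 2 * (c * a) → Winning 1 h
  finalRound {c} {h} {q} I split half enough b b≤a
    with k , t , k+t≡q , budget , P ← split (inner-round I b b≤a) =
    proj₁ move , new A ++ old A , (#F , disjoint A) , F⊆
    where
    open Augmentation
    module P = Packing P
    E = b ++ breakerClaimed h
    -- The edges of the current move are included: augmenting through one of them does no harm, as
    -- it is claimed all the same.
    M = P.edges ++ makerClaimed h
    #M : length M ≡ k + c * a
    #M = trans (length-++ P.edges) (cong₂ _+_ P.#edges (#maker I))
    open ≤-Reasoning
    A : Augmentation P.rest E M t
    A = augment t P.rest-unique P.#rest (packing-matching I b b≤a P) (rest-avoids-all I b b≤a P) (begin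
      length E + 2 * t     ≤⟨ +-mono-≤ (#breaker′ I b b≤a) (≤-trans (m≤n+m (2 * t) k) budget) ⟩
      suc c * a + a        ≤⟨ enough ⟩
      2 * (c * a)          ≤⟨ *-monoʳ-≤ 2 (m≤n+m (c * a) k) ⟩
      2 * (k + c * a)      ≡⟨ cong (2 *_) #M ⟨
      2 * length M         ∎)
    picked = P.edges ++ new A
    picked-unique : Unique picked
    picked-unique = Unique.++⁺ (matching-unique P.disjoint)
      (matching-unique (AllPairs-prefix (new A) (disjoint A))) λ (d∈P , d∈A) →
        let u , u∈ , u∈d = find (touches A d∈A) in P.rest-avoids u∈ d∈P u∈d
    picked-fresh : ∀ {d} → d ∈ picked → d ∉ b ++ claimed h
    picked-fresh d∈ with ∈-++⁻ P.edges d∈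
    ... | inj₁ d∈P = packing-fresh I b b≤a P d∈P
    ... | inj₂ d∈A with u , u∈ , u∈d ← find (touches A d∈A) =
      fresh I b b≤a (free A d∈A) (lose (P.rest⊆U u∈) u∈d)
    move = completeMove picked picked-unique picked-fresh
      (≤-trans (≤-reflexive (trans (length-++ P.edges) (cong₂ _+_ P.#edges (#new A)))) budget)
    #F : length (new A ++ old A) ≡ ⌊ n /2⌋
    #F = begin-equality
      length (new A ++ old A) ≡⟨ #all A ⟩
      t + length M ≡⟨ cong (t +_) #M ⟩
      t + (k + c * a) ≡⟨ +-assoc t k (c * a) ⟨
      t + k + c * a ≡⟨ cong (_+ c * a) (trans (+-comm t k) k+t≡q) ⟩
      q + c * a ≡⟨ half ⟩
      ⌊ n /2⌋ ∎
    F⊆ : new A ++ old A ⊆ picks (proj₁ move) ++ makerClaimed h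
    F⊆ d∈ with ∈-++⁻ (new A) d∈
    ... | inj₁ d∈new = ∈-++⁺ˡ (proj₂ move (∈-++⁺ʳ P.edges d∈new))
    ... | inj₂ d∈old with ∈-++⁻ P.edges (old⊆M A d∈old)
    ...   | inj₁ d∈P = ∈-++⁺ˡ (proj₂ move (∈-++⁺ˡ d∈P))
    ...   | inj₂ d∈M = ∈-++⁺ʳ (picks (proj₁ move)) d∈M

-- One edge per move on an even number of vertices

module _ {n : ℕ} where

  open Edge
  open MakerBreaker (Edge n) (PerfectMatching n) 1
  open Games _≟ᵉ_ allEdges ∈-allEdges (PerfectMatching n) 1

  disjoint-join : ∀ {u v : Fin n} (e f : Edge n) → Joins u v e → u ≢ v →
    ¬ (u ∈ᵉ f) → ¬ (v ∈ᵉ f) → Disjoint e f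
  disjoint-join e f (u∈e , v∈e) u≢v u∉f v∉f w (w∈e , w∈f) with endpoints e u∈e v∈e u≢v w∈e
  ... | inj₁ refl = u∉f w∈f
  ... | inj₂ refl = v∉f w∈f

  ∉-join : ∀ {u v w : Fin n} (e : Edge n) → Joins u v e → u ≢ v → w ≢ u → w ≢ v → ¬ (w ∈ᵉ e)
  ∉-join e (u∈e , v∈e) u≢v w≢u w≢v w∈e = [ w≢u , w≢v ]′ (endpoints e u∈e v∈e u≢v w∈e)

  doubleThreat : ∀ {h g g′} → g ∉ claimed h → g′ ∉ claimed h → g ≢ g′ →
    (∃ λ F → PerfectMatching n F × F ⊆ g ∷ makerClaimed h) →
    (∃ λ F → PerfectMatching n F × F ⊆ g′ ∷ makerClaimed h) → Winning 1 h
  doubleThreat {h} {g} {g′} g∉ g′∉ g≢g′ win win′ b b≤1 = reply b b≤1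
    where
    take-edge : ∀ {b} d → d ∉ b → d ∉ claimed h → (∃ λ F → PerfectMatching n F × F ⊆ d ∷ makerClaimed h) →
      Σ[ m ∈ Move (b ++ claimed h) ] Winning 0 ((b , picks m) ∷ h)
    take-edge {b} d d∉b d∉h won = exactMove ([] ∷ [])
      (λ { (here refl) d∈ → [ d∉b , d∉h ]′ (∈-++⁻ b d∈) }) refl , won
    reply : ∀ b → length b ≤ 1 → Σ[ m ∈ Move (b ++ claimed h) ] Winning 0 ((b , picks m) ∷ h)
    reply [] _ = take-edge g (λ ()) g∉ win
    reply (d ∷ []) _ with g ≟ᵉ d
    ... | no g≢d   = take-edge g (λ { (here g≡d) → g≢d g≡d }) g∉ win
    ... | yes refl = take-edge g′ (λ { (here g′≡g) → g≢g′ (sym g′≡g) }) g′∉ win′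
    reply (_ ∷ _ ∷ _) (s≤s ())

  -- Maker's path p - x - y (with the matching edge f = xy) leaves either p or y free to be
  -- matched to a vertex of T, so that the last edge can be chosen as a double threat.
  record Fork (h : History) : Set where
    field
      {p x y}  : Fin n
      {T}      : List (Fin n)
      {M}      : List (Edge n)
      {f px}   : Edge n
      T-unique : Unique T
      #T       : length T ≡ 3
      p∉T      : p ∉ T
      matching : AllPairs Disjoint M
      avoids   : Avoids (p ∷ T) M
      f∈M      : f ∈ M
      x∈f      : x ∈ᵉ f
      y∈f      : y ∈ᵉ f
      x≢y      : x ≢ y
      joins-px : Joins p x px
      claims   : makerClaimed h ≡ px ∷ M
      #M       : 2 + length M ≡ ⌊ n /2⌋
      few      : count (within? (y ∷ p ∷ T)) (breakerClaimed h) ≤ 1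

  -- Maker takes the side ww′ of T opposite to some z and threatens zp and zy. The edge zp completes
  -- M, with `px` wasted; zy completes M with f replaced by `px`. Breaker has at most two edges
  -- among y, p and T, each spoiling at most one of the three choices of z.
  fork-wins : ∀ {h} → Fork h → Winning 2 h
  fork-wins {h} K b b≤1 = reply
    where
    open Fork K
    E = b ++ breakerClaimed h
    S = y ∷ p ∷ T
    es = filter (within? S) E

    y∉T : y ∉ T
    y∉T y∈T = avoids (there y∈T) f∈M y∈f

    p≢y : p ≢ y
    p≢y refl = avoids (here refl) f∈M y∈f

    p≢x : p ≢ x
    p≢x refl = avoids (here refl) f∈M x∈f

    -- For e inside S, the second alternative is the side of T opposite to z.
    Obstructs : Fin n → Edge n → Set
    Obstructs z e = z ∈ᵉ e × (p ∈ᵉ e ⊎ y ∈ᵉ e) ⊎ ¬ (z ∈ᵉ e) × ¬ (p ∈ᵉ e) × ¬ (y ∈ᵉ e)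

    obstructs? : ∀ z e → Dec (Obstructs z e)
    obstructs? z e = z ∈ᵉ? e ×-dec (p ∈ᵉ? e ⊎-dec y ∈ᵉ? e)
      ⊎-dec ¬? (z ∈ᵉ? e) ×-dec ¬? (p ∈ᵉ? e) ×-dec ¬? (y ∈ᵉ? e)

    es< : length es < 1 * length T
    es< rewrite #T = s≤s (begin
      count (within? S) E ≡⟨ count-++ (within? S) b _ ⟩
      count (within? S) b + count (within? S) (breakerClaimed h)
        ≤⟨ +-mono-≤ (≤-trans (length-filter (within? S) b) b≤1) few ⟩
      2 ∎)
      where open ≤-Reasoning

    two-in-T : ∀ {e z z′} → z ∈ T → z′ ∈ T → z ≢ z′ → z ∈ᵉ e → z′ ∈ᵉ e → ¬ (p ∈ᵉ e ⊎ y ∈ᵉ e)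
    two-in-T {e} z∈T z′∈T z≢z′ z∈e z′∈e (inj₁ p∈e) =
      [ (λ { refl → p∉T z∈T }) , (λ { refl → p∉T z′∈T }) ]′ (endpoints e z∈e z′∈e z≢z′ p∈e)
    two-in-T {e} z∈T z′∈T z≢z′ z∈e z′∈e (inj₂ y∈e) =
      [ (λ { refl → y∉T z∈T }) , (λ { refl → y∉T z′∈T }) ]′ (endpoints e z∈e z′∈e z≢z′ y∈e)

    in-T : ∀ {e v} → Within S e → ¬ (p ∈ᵉ e) → ¬ (y ∈ᵉ e) → v ∈ᵉ e → v ∈ T
    in-T {e} w p∉ y∉ v∈ with within⇒∈ e w v∈
    ... | here refl         = contradiction v∈ y∉
    ... | there (here refl) = contradiction v∈ p∉
    ... | there (there v∈T) = v∈T

    obstructs-func : ∀ {e z z′} → e ∈ es → z ∈ T → z′ ∈ T → Obstructs z e → Obstructs z′ e → z ≡ z′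
    obstructs-func {e} {z} {z′} e∈ z∈T z′∈T o o′ with z ≟ᶠ z′
    ... | yes z≡z′ = z≡z′
    ... | no  z≢z′ with o | o′
    ...   | inj₁ (z∈e , py) | inj₁ (z′∈e , _) = contradiction py (two-in-T {e} z∈T z′∈T z≢z′ z∈e z′∈e)
    ...   | inj₁ (_ , py) | inj₂ (_ , p∉ , y∉) = contradiction py [ p∉ , y∉ ]′
    ...   | inj₂ (_ , p∉ , y∉) | inj₁ (_ , py) = contradiction py [ p∉ , y∉ ]′
    -- An edge inside T missing both z and z′ would give T four vertices.
    ...   | inj₂ (z∉ , p∉ , y∉) | inj₂ (z′∉ , _) =
      contradiction (≤-trans (length-⊆ four-unique four⊆T) (≤-reflexive #T)) (n≮n 3)
      where
      inside = proj₂ (∈-filter⁻ (within? S) {xs = E} e∈)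
      at-T : ∀ {v} → v ∈ᵉ e → v ∈ T
      at-T = in-T {e} inside p∉ y∉
      four-unique : Unique (lo e ∷ hi e ∷ z ∷ z′ ∷ [])
      four-unique = (lo≢hi e ∷ (λ { refl → z∉ (inj₁ refl) }) ∷ (λ { refl → z′∉ (inj₁ refl) }) ∷ [])
                  ∷ ((λ { refl → z∉ (inj₂ refl) }) ∷ (λ { refl → z′∉ (inj₂ refl) }) ∷ [])
                  ∷ (z≢z′ ∷ []) ∷ [] ∷ []
      four⊆T : lo e ∷ hi e ∷ z ∷ z′ ∷ [] ⊆ T
      four⊆T (here refl) = at-T (inj₁ refl)
      four⊆T (there (here refl)) = at-T (inj₂ refl)
      four⊆T (there (there (here refl))) = z∈T
      four⊆T (there (there (there (here refl)))) = z′∈T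

    ∈∉⇒≢ : ∀ {u v : Fin n} {V} → u ∈ V → v ∉ V → u ≢ v
    ∈∉⇒≢ u∈V v∉V refl = v∉V u∈V

    Reply = Σ[ m ∈ Move (b ++ claimed h) ] Winning 1 ((b , picks m) ∷ h)

    reply : Reply
    reply =
      let z , z∈T , none = pigeonhole obstructs? 1 {T} {es} T-unique (λ {e} → obstructs-func {e}) es<
          w , w′ , w∈ , w′∈ , w≢w′ = two-elements (Unique.filter⁺ _ T-unique)
            (≤-pred (≤-trans (≤-reflexive (sym #T)) (length-remove _≟ᶠ_ z T-unique)))
          w∈T , w≢z = ∈-remove⁻ _≟ᶠ_ {xs = T} w∈
          w′∈T , w′≢z = ∈-remove⁻ _≟ᶠ_ {xs = T} w′∈
          g , joins-g = joining w≢w′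
          zp , joins-zp = joining (∈∉⇒≢ z∈T p∉T)
          zy , joins-zy = joining (∈∉⇒≢ z∈T y∉T)
      in threaten g zp zy z∈T w∈T w′∈T w≢w′ w≢z w′≢z joins-g joins-zp joins-zy none
      where
      threaten : ∀ {z w w′} g zp zy → z ∈ T → w ∈ T → w′ ∈ T → w ≢ w′ → w ≢ z → w′ ≢ z →
        Joins w w′ g → Joins z p zp → Joins z y zy → count (obstructs? z) es < 1 → Reply
      threaten {z} {w} {w′} g zp zy z∈T w∈T w′∈T w≢w′ w≢z w′≢z
          (w∈g , w′∈g) (z∈zp , p∈zp) (z∈zy , y∈zy) none
        = exactMove ([] ∷ []) (λ { (here refl) → untaken w∈T w∈g g∉E }) refl
        , doubleThreat {(b , g ∷ []) ∷ h} {zp} {zy}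
            (λ { (here refl) → z∉g z∈zp ; (there zp∈) → untaken z∈T z∈zp zp∉E zp∈ })
            (λ { (here refl) → z∉g z∈zy ; (there zy∈) → untaken z∈T z∈zy zy∉E zy∈ })
            (λ { refl → ∉-join zy (z∈zy , y∈zy) (∈∉⇒≢ z∈T y∉T) (∈∉⇒≢ z∈T p∉T ∘ sym) p≢y p∈zp })
            (zp ∷ g ∷ M , (#M , (zp-g ∷ All.tabulate zp-M) ∷ All.tabulate g-M ∷ matching) ,
              λ { (here refl) → here refl
                ; (there (here refl)) → there (here refl)
                ; (there (there e∈M)) → there (there (M⊆ e∈M)) })
            (zy ∷ g ∷ px ∷ M′ ,
                (trans (cong (2 +_) (sym (length-remove-∈ _≟ᵉ_ (matching-unique matching) f∈M))) #M ,
                (zy-g ∷ zy-px ∷ All.tabulate zy-M′) ∷ (g-px ∷ All.tabulate (g-M ∘ M′⊆M))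
                ∷ All.tabulate px-M′ ∷ AllPairs.filter⁺ _ matching) ,
              λ { (here refl) → here refl
                ; (there (here refl)) → there (here refl)
                ; (there (there (here refl))) → there (there (subst (px ∈_) (sym claims) (here refl)))
                ; (there (there (there e∈M′))) → there (there (M⊆ (M′⊆M e∈M′))) })
        where
        unobstructed : ∀ {e u v} → u ∈ S → v ∈ S → u ≢ v → Joins u v e → Obstructs z e → e ∉ E
        unobstructed {e} u∈S v∈S u≢v joins obstructs e∈E = contradiction none (≤⇒≯
          (filter-some (obstructs? z) (lose
            (∈-filter⁺ (within? S) e∈E (∈⇒within e u≢v u∈S v∈S joins)) obstructs)))

        ∉px : ∀ {t} → t ∈ T → ¬ (t ∈ᵉ px)
        ∉px t∈T = ∉-join px joins-px p≢x (∈∉⇒≢ t∈T p∉T) λ { refl → avoids (there t∈T) f∈M x∈f }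

        M⊆ : M ⊆ makerClaimed h
        M⊆ e∈M = subst (_ ∈_) (sym claims) (there e∈M)

        untaken : ∀ {t e} → t ∈ T → t ∈ᵉ e → e ∉ E → e ∉ b ++ claimed h
        untaken {t} {e} t∈T t∈e e∉E e∈ with ∈-++⁻ b e∈
        ... | inj₁ e∈b = e∉E (∈-++⁺ˡ e∈b)
        ... | inj₂ e∈h with claimed⁻ h e∈h
        ...   | inj₂ e∈B = e∉E (∈-++⁺ʳ b e∈B)
        ...   | inj₁ e∈maker with subst (e ∈_) claims e∈maker
        ...     | here refl = ∉px t∈T t∈e
        ...     | there e∈M = avoids (there t∈T) e∈M t∈e

        ∉g : ∀ {v} → v ≢ w → v ≢ w′ → ¬ (v ∈ᵉ g)
        ∉g = ∉-join g (w∈g , w′∈g) w≢w′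

        z∉g : ¬ (z ∈ᵉ g)
        z∉g = ∉g (w≢z ∘ sym) (w′≢z ∘ sym)

        p∉g : ¬ (p ∈ᵉ g)
        p∉g = ∉g (∈∉⇒≢ w∈T p∉T ∘ sym) (∈∉⇒≢ w′∈T p∉T ∘ sym)

        y∉g : ¬ (y ∈ᵉ g)
        y∉g = ∉g (∈∉⇒≢ w∈T y∉T ∘ sym) (∈∉⇒≢ w′∈T y∉T ∘ sym)

        g∉E : g ∉ E
        g∉E = unobstructed (there (there w∈T)) (there (there w′∈T)) w≢w′ (w∈g , w′∈g)
          (inj₂ (z∉g , p∉g , y∉g))

        zp∉E : zp ∉ E
        zp∉E = unobstructed (there (there z∈T)) (there (here refl)) (∈∉⇒≢ z∈T p∉T) (z∈zp , p∈zp)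
          (inj₁ (z∈zp , inj₁ p∈zp))

        zy∉E : zy ∉ E
        zy∉E = unobstructed (there (there z∈T)) (here refl) (∈∉⇒≢ z∈T y∉T) (z∈zy , y∈zy)
          (inj₁ (z∈zy , inj₂ y∈zy))

        M′ = remove _≟ᵉ_ f M

        M′⊆M : M′ ⊆ M
        M′⊆M = proj₁ ∘ ∈-remove⁻ _≟ᵉ_

        ∉M′ : ∀ {v e} → v ∈ᵉ f → e ∈ M′ → ¬ (v ∈ᵉ e)
        ∉M′ v∈f e∈M′ v∈e with e∈M , e≢f ← ∈-remove⁻ _≟ᵉ_ {xs = M} e∈M′ =
          e≢f (matching-≡ matching e∈M f∈M v∈e v∈f)

        zp-g : Disjoint zp g
        zp-g = disjoint-join zp g (z∈zp , p∈zp) (∈∉⇒≢ z∈T p∉T) z∉g p∉g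

        zp-M : ∀ {e} → e ∈ M → Disjoint zp e
        zp-M {e} e∈M = disjoint-join zp e (z∈zp , p∈zp) (∈∉⇒≢ z∈T p∉T)
          (avoids (there z∈T) e∈M) (avoids (here refl) e∈M)

        g-M : ∀ {e} → e ∈ M → Disjoint g e
        g-M {e} e∈M = disjoint-join g e (w∈g , w′∈g) w≢w′
          (avoids (there w∈T) e∈M) (avoids (there w′∈T) e∈M)

        g-px : Disjoint g px
        g-px = disjoint-join g px (w∈g , w′∈g) w≢w′ (∉px w∈T) (∉px w′∈T)

        zy-g : Disjoint zy g
        zy-g = disjoint-join zy g (z∈zy , y∈zy) (∈∉⇒≢ z∈T y∉T) z∉g y∉g

        zy-px : Disjoint zy px
        zy-px = disjoint-join zy px (z∈zy , y∈zy) (∈∉⇒≢ z∈T y∉T) (∉px z∈T)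
          (∉-join px joins-px p≢x (p≢y ∘ sym) (x≢y ∘ sym))

        zy-M′ : ∀ {e} → e ∈ M′ → Disjoint zy e
        zy-M′ {e} e∈M′ = disjoint-join zy e (z∈zy , y∈zy) (∈∉⇒≢ z∈T y∉T)
          (avoids (there z∈T) (M′⊆M e∈M′)) (∉M′ y∈f e∈M′)

        px-M′ : ∀ {e} → e ∈ M′ → Disjoint px e
        px-M′ {e} e∈M′ = disjoint-join px e joins-px p≢x (avoids (here refl) (M′⊆M e∈M′)) (∉M′ x∈f e∈M′)

  quiet-side : ∀ {W : List (Fin n)} {E : List (Edge n)} {u v z : Fin n} f → Quiet W E f →
    u ∈ W → v ∈ W → u ≢ v → z ∈ᵉ f →
    ¬ Blocked E u z ⊎ ¬ Blocked E v z
  quiet-side {E = E} {u} {z = z} f quiet u∈W v∈W u≢v z∈f with blocked? E u z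
  ... | no ¬bl = inj₁ ¬bl
  ... | yes bl = inj₂ λ bl′ → u≢v (proj₁ (quiet u∈W v∈W z∈f z∈f bl bl′))

  orient-quiet : ∀ {W : List (Fin n)} {E : List (Edge n)} f → Quiet W E f →
    ∃₂ λ x y → x ∈ᵉ f × y ∈ᵉ f × x ≢ y × (∀ {w} → w ∈ W → ¬ Blocked E w y)
  orient-quiet {W} {E} f quiet with any? (λ w → blocked? E w (lo f)) W
  ... | no none   = hi f , lo f , inj₂ refl , inj₁ refl , lo≢hi f ∘ sym , λ w∈W bl → none (lose w∈W bl)
  ... | yes found with t , t∈W , bl ← find found = lo f , hi f , inj₁ refl , inj₂ refl , lo≢hi f ,
    λ w∈W bl′ → lo≢hi f (proj₂ (quiet t∈W w∈W (inj₁ refl) (inj₂ refl) bl bl′))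

  -- Breaker has at most one edge among four uncovered vertices W. An f with at most one of his
  -- edges to W has an end y with none, so he still has at most one edge among y and W; and of two
  -- vertices of W at least one can be joined to the other end x. Such an f exists because c + 1 < 2
  -- c.
  forkRound : ∀ {c h} → Clean {n} {1} c h → 2 * (2 + c) ≤ n → 2 ≤ c → 2 + c ≡ ⌊ n /2⌋ → Winning 3 h
  forkRound {c} {h} I room 2≤c half b b≤1 = reply
    where
    open Clean I
    E = b ++ breakerClaimed h

    Reply = Σ[ m ∈ Move (b ++ claimed h) ] Winning 2 ((b , picks m) ∷ h)

    4≤U : 4 ≤ length U
    4≤U = +-cancelˡ-≤ (2 * (c * 1)) _ _ (≤-trans (≤-reflexive (eq c)) (≤-trans room #U))
      where
      eq : ∀ c → 2 * (c * 1) + 4 ≡ 2 * (2 + c)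
      eq = solve-∀

    short : length E < 2 * length (makerClaimed h)
    short = begin-strict
      length E                     ≤⟨ #breaker′ I b b≤1 ⟩
      suc c * 1                    ≡⟨ eq c ⟩
      suc c                        <⟨ +-monoˡ-≤ c 2≤c ⟩
      c + c                        ≡⟨ eq′ c ⟩
      2 * (c * 1)                  ≡⟨ cong (2 *_) #maker ⟨
      2 * length (makerClaimed h)  ∎
      where
      open ≤-Reasoning
      eq : ∀ c → suc c * 1 ≡ suc c
      eq = solve-∀
      eq′ : ∀ c → c + c ≡ 2 * (c * 1)
      eq′ = solve-∀

    build : ∀ {p q r s f x y} → Unique (p ∷ q ∷ r ∷ s ∷ []) → p ∷ q ∷ r ∷ s ∷ [] ⊆ U →
      f ∈ makerClaimed h → x ∈ᵉ f → y ∈ᵉ f → x ≢ y →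
      (∀ {w} → w ∈ p ∷ q ∷ r ∷ s ∷ [] → ¬ Blocked E w y) → ¬ Blocked E p x → Reply
    build {p} {q} {r} {s} {f} {x} {y} W!@(p≢T ∷ T!) W⊆U f∈M x∈f y∈f x≢y ¬bl-y ¬bl
      with px , p∈px , x∈px ← joining {u = p} {x} (λ { refl → avoids (W⊆U (here refl)) f∈M x∈f })
      = exactMove ([] ∷ []) (λ { (here refl) →
          fresh I b b≤1 (¬blocked⇒∉ ¬bl p∈px x∈px) (lose (W⊆U (here refl)) p∈px) }) refl
      , fork-wins {(b , px ∷ []) ∷ h} (record
        { T-unique = T!
        ; #T = refl
        ; p∉T = λ p∈T → All.lookup p≢T p∈T refl
        ; matching = matching
        ; avoids = avoids ∘ W⊆U
        ; f∈M = f∈M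
        ; x∈f = x∈f
        ; y∈f = y∈f
        ; x≢y = x≢y
        ; joins-px = p∈px , x∈px
        ; claims = refl
        ; #M = trans (cong (2 +_) (trans #maker (*-identityʳ c))) half
        ; few = begin
            count (within? (y ∷ W)) E ≤⟨ count-mono (within? (y ∷ W)) (within? W) E not-y ⟩
            inner W E                 ≤⟨ inner-mono W⊆U E ⟩
            inner U E                 ≤⟨ inner-round I b b≤1 ⟩
            1                         ∎
        })
      where
      open ≤-Reasoning
      W = p ∷ q ∷ r ∷ s ∷ []
      not-y : ∀ {e} → e ∈ E → Within (y ∷ W) e → Within W e
      not-y {e} e∈E (here refl , here hi≡) = contradiction (sym hi≡) (lo≢hi e)
      not-y e∈E (here refl , there hi∈) = contradiction (lose e∈E (inj₂ refl , inj₁ refl)) (¬bl-y hi∈)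
      not-y e∈E (there lo∈ , here refl) = contradiction (lose e∈E (inj₁ refl , inj₂ refl)) (¬bl-y lo∈)
      not-y e∈E (there lo∈ , there hi∈) = lo∈ , hi∈

    swap⊆ : ∀ {p q : Fin n} {V} → q ∷ p ∷ V ⊆ p ∷ q ∷ V
    swap⊆ (here refl)         = there (here refl)
    swap⊆ (there (here refl)) = here refl
    swap⊆ (there (there v∈))  = there (there v∈)

    reply : Reply
    reply
      with p , q , r , s , W!@((p≢q ∷ p≢T) ∷ q≢T ∷ T!) , W⊆U ← four-elements U-unique 4≤U
      with f , f∈M , quiet ← quietEdge {W = p ∷ q ∷ r ∷ s ∷ []} {E = E} matching (avoids ∘ W⊆U) short
      with x , y , x∈f , y∈f , x≢y , ¬bl-y ← orient-quiet {E = E} f quiet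
      with quiet-side {E = E} f quiet (here refl) (there (here refl)) p≢q x∈f
    ... | inj₁ ¬bl = build W! W⊆U f∈M x∈f y∈f x≢y ¬bl-y ¬bl
    ... | inj₂ ¬bl = build ((p≢q ∘ sym ∷ q≢T) ∷ p≢T ∷ T!) (W⊆U ∘ swap⊆)
        f∈M x∈f y∈f x≢y (¬bl-y ∘ swap⊆) ¬bl

-- The value of optimalTime

if-yes : ∀ {P A : Set} (P? : Dec P) {x y : A} → P → (if ⌊ P? ⌋ then x else y) ≡ x
if-yes (yes _) _ = refl
if-yes (no ¬p) p = contradiction p ¬p

if-no : ∀ {P A : Set} (P? : Dec P) {x y : A} → ¬ P → (if ⌊ P? ⌋ then x else y) ≡ y
if-no (yes p) ¬p = contradiction p ¬p
if-no (no _)  _  = refl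

[r+k*d]/d≡k : ∀ r k d .{{_ : NonZero d}} → r < d → (r + k * d) / d ≡ k
[r+k*d]/d≡k r k d r<d = begin
  (r + k * d) / d     ≡⟨ +-distrib-/-∣ʳ r (n∣m*n k) ⟩
  r / d + k * d / d   ≡⟨ cong₂ _+_ (m<n⇒m/n≡0 r<d) (m*n/n≡m k d) ⟩
  k                   ∎
  where open ≡-Reasoning

even-or-odd : ∀ n → n ≡ 2 * ⌊ n /2⌋ ⊎ n ≡ suc (2 * ⌊ n /2⌋)
even-or-odd 0 = inj₁ refl
even-or-odd 1 = inj₂ refl
even-or-odd (suc (suc n)) with even-or-odd n
... | inj₁ eq = inj₁ (trans (cong (2 +_) eq) (sym (*-suc 2 ⌊ n /2⌋)))
... | inj₂ eq = inj₂ (trans (cong (2 +_) eq) (cong suc (sym (*-suc 2 ⌊ n /2⌋))))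

2∤1+2* : ∀ m → ¬ 2 ∣ suc (2 * m)
2∤1+2* m 2∣ = contradiction (∣m+n∣m⇒∣n (subst (2 ∣_) (+-comm 1 (2 * m)) 2∣) (m∣m*n m)) (>⇒∤ ≤-refl)

suc[d∸1]≡d : ∀ d .{{_ : NonZero d}} → suc (d ∸ 1) ≡ d
suc[d∸1]≡d (suc _) = refl

module _ (a : ℕ) .{{a≢0 : NonZero a}} where

  private instance
    2a≢0 : NonZero (2 * a)
    2a≢0 = m*n≢0 2 a

  ceil : ∀ r k → r < 2 * a → ⌈ suc r + k * (2 * a) / 2 * a ⌉ ≡ suc k
  ceil r k r< = trans (cong (_/ (2 * a)) eq) ([r+k*d]/d≡k r (suc k) (2 * a) r<)
    where
    shuffle : ∀ r x y → suc r + x + y ≡ r + (suc y + x)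
    shuffle = solve-∀
    eq : suc r + k * (2 * a) + (2 * a ∸ 1) ≡ r + suc k * (2 * a)
    eq = trans (shuffle r (k * (2 * a)) (2 * a ∸ 1))
      (cong (λ z → r + (z + k * (2 * a))) (suc[d∸1]≡d (2 * a)))

  optimalTime-special : ∀ n → a ≡ 1 → n ≡ 2 * ⌊ n /2⌋ → optimalTime a n ≡ suc ⌊ n /2⌋
  optimalTime-special n refl even = trans (if-yes ((1 ≟ 1) ×-dec (2 ∣? n)) (refl , 2∣n))
    (trans (+-comm _ 1) (cong suc
      (trans (cong (_/ 2) (trans even (*-comm 2 ⌊ n /2⌋))) (m*n/n≡m ⌊ n /2⌋ 2))))
    where
    2∣n : 2 ∣ n
    2∣n = subst (2 ∣_) (sym even) (m∣m*n ⌊ n /2⌋)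

  -- Here n exceeds (c + 1) 2 a by one, so the ceiling is c + 2; subtracting 1 discounts the vertex
  -- that stays unmatched.
  optimalTime-exact : ∀ n c → n ≡ suc (2 * ⌊ n /2⌋) → a + c * a ≡ ⌊ n /2⌋ → optimalTime a n ≡ suc c
  optimalTime-exact n c odd half = begin
    optimalTime a n
      ≡⟨ if-no ((a ≟ 1) ×-dec (2 ∣? n)) (λ (_ , 2∣n) → 2∤1+2* ⌊ n /2⌋ (subst (2 ∣_) odd 2∣n)) ⟩
    _ ≡⟨ if-yes ((2 * a) ∣? (n ∸ 1)) (subst (2 * a ∣_) (sym (cong (_∸ 1) n≡)) (n∣m*n (suc c))) ⟩
    ⌈ n / 2 * a ⌉ ∸ 1 ≡⟨ cong (λ m → ⌈ m / 2 * a ⌉ ∸ 1) n≡ ⟩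
    ⌈ suc (suc c * (2 * a)) / 2 * a ⌉ ∸ 1 ≡⟨ cong (_∸ 1) (ceil 0 (suc c) (>-nonZero⁻¹ (2 * a))) ⟩
    suc c ∎
    where
    open ≡-Reasoning
    shuffle : ∀ a c → 2 * (a + c * a) ≡ suc c * (2 * a)
    shuffle = solve-∀
    n≡ : n ≡ suc (suc c * (2 * a))
    n≡ = trans odd (cong suc (trans (cong (2 *_) (sym half)) (shuffle a c)))

  -- The excess of n over c 2 a lies between 2 and 2 a: an excess of 1 would make n - 1 a multiple
  -- of 2 a.
  optimalTime-generic : ∀ n r c → ¬ (a ≡ 1 × 2 ∣ n) → n ≡ suc (suc r) + c * (2 * a) → suc r < 2 * a →
    optimalTime a n ≡ suc c
  optimalTime-generic n r c ¬special n≡ r< = begin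
    optimalTime a n ≡⟨ if-no ((a ≟ 1) ×-dec (2 ∣? n)) ¬special ⟩
    _ ≡⟨ if-no ((2 * a) ∣? (n ∸ 1)) (λ 2a∣ → >⇒∤ r< (∣m+n∣m⇒∣n (subst (2 * a ∣_) n∸1≡ 2a∣) (n∣m*n c))) ⟩
    ⌈ n / 2 * a ⌉ ≡⟨ cong ⌈_/ 2 * a ⌉ n≡ ⟩
    ⌈ suc (suc r) + c * (2 * a) / 2 * a ⌉ ≡⟨ ceil (suc r) c r< ⟩
    suc c ∎
    where
    open ≡-Reasoning
    n∸1≡ : n ∸ 1 ≡ c * (2 * a) + suc r
    n∸1≡ = trans (cong (_∸ 1) n≡) (+-comm (suc r) (c * (2 * a)))

-- Winning times for all large n

module _ {n : ℕ} where

  wins-special : ∀ c → 2 ≤ c → 2 + c ≡ ⌊ n /2⌋ → n ≡ 2 * ⌊ n /2⌋ →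
    MakerBreaker.MakerWinsWithin (Edge n) (PerfectMatching n) 1 (suc ⌊ n /2⌋)
  wins-special c 2≤c half even = winning⇒winsWithin (subst (λ t → Winning t []) #rounds
    (cleaningPhase c clean-start small λ {h} I → forkRound (subst (λ z → Clean z h) (+-identityʳ c) I)
      (≤-reflexive (trans (cong (2 *_) half) (sym even))) 2≤c half))
    where
    open Games _≟ᵉ_ allEdges ∈-allEdges (PerfectMatching n) 1
    -- The last two pairs take three moves: the path edge, the side of T, and whichever threat
    -- Breaker leaves open.
    #rounds : c + 3 ≡ suc ⌊ n /2⌋
    #rounds = trans (+-comm c 3) (cong suc half)
    small : 2 * ((c + 0) * 1) < n
    small = subst₂ _<_ (sym (cong (2 *_) (trans (*-identityʳ (c + 0)) (+-identityʳ c))))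
      (trans (cong (2 *_) half) (sym even)) (*-monoʳ-< 2 (m<n+m c {2} z<s))

  -- The alternatives correspond to `splitEven`, which requires a ≥ 2 and sets a possible odd vertex
  -- aside, and `splitOdd`, which also covers a = 1.
  wins : ∀ {a} c q → 0 < q → q ≤ a → 2 ≤ c → q + c * a ≡ ⌊ n /2⌋ →
    (2 ≤ a × 2 * ⌊ n /2⌋ ≤ n) ⊎ (q ≡ a × n ≡ suc (2 * ⌊ n /2⌋)) →
    MakerBreaker.MakerWinsWithin (Edge n) (PerfectMatching n) a (suc c)
  wins {a} c q 0<q q≤a 2≤c half cases = winning⇒winsWithin (subst (λ t → Winning t []) (+-comm c 1)
    (cleaningPhase c clean-start small λ {h} I → last (subst (λ z → Clean z h) (+-identityʳ c) I)))
    where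
    open MakerBreaker (Edge n) (PerfectMatching n) a
    open Games _≟ᵉ_ allEdges ∈-allEdges (PerfectMatching n) a

    2N≤n : 2 * ⌊ n /2⌋ ≤ n
    2N≤n = [ proj₂ , (λ (_ , odd) → ≤-trans (n≤1+n _) (≤-reflexive (sym odd))) ]′ cases

    small : 2 * ((c + 0) * a) < n
    small rewrite +-identityʳ c = <-≤-trans (*-monoʳ-< 2 (subst (c * a <_) half (m<n+m (c * a) 0<q))) 2N≤n

    enough : suc c * a + a ≤ 2 * (c * a)
    enough = ≤-trans (≤-reflexive (eq c a))
      (≤-trans (+-monoˡ-≤ (c * a) (*-monoˡ-≤ a 2≤c)) (≤-reflexive (eq′ (c * a))))
      where
      eq : ∀ c a → suc c * a + a ≡ 2 * a + c * a
      eq = solve-∀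
      eq′ : ∀ m → m + m ≡ 2 * m
      eq′ = solve-∀

    last : ∀ {h} → Clean c h → Winning 1 h
    last I = finalRound I (split cases) half enough
      where
      open Clean I
      split : (2 ≤ a × 2 * ⌊ n /2⌋ ≤ n) ⊎ (q ≡ a × n ≡ suc (2 * ⌊ n /2⌋)) →
        ∀ {E} → inner U E ≤ a → MixedPacking U E q a
      split (inj₁ (2≤a , even)) few = splitEven 2≤a q≤a U-unique (+-cancelˡ-≤ (2 * (c * a)) _ _ (begin
        2 * (c * a) + 2 * q ≡⟨ eq q (c * a) ⟩
        2 * (q + c * a) ≡⟨ cong (2 *_) half ⟩
        2 * ⌊ n /2⌋ ≤⟨ 2N≤n ⟩
        n ≤⟨ #U ⟩
        2 * (c * a) + length U ∎)) few
        where
        open ≤-Reasoning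
        eq : ∀ q m → 2 * m + 2 * q ≡ 2 * (q + m)
        eq = solve-∀
      split (inj₂ (refl , odd)) few = splitOdd U-unique (+-cancelˡ-≤ (2 * (c * a)) _ _ (begin
        2 * (c * a) + (2 * a + 1) ≡⟨ eq a (c * a) ⟩
        suc (2 * (a + c * a)) ≡⟨ cong (λ m → suc (2 * m)) half ⟩
        suc (2 * ⌊ n /2⌋) ≡⟨ odd ⟨
        n ≤⟨ #U ⟩
        2 * (c * a) + length U ∎)) few
        where
        open ≤-Reasoning
        eq : ∀ q m → 2 * m + (2 * q + 1) ≡ suc (2 * (q + m))
        eq = solve-∀

  tau-special : ∀ c → 2 ≤ c → 2 + c ≡ ⌊ n /2⌋ → n ≡ 2 * ⌊ n /2⌋ →
    MakerBreaker.IsTau (Edge n) (PerfectMatching n) 1 (suc ⌊ n /2⌋)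
  tau-special c 2≤c half even = wins-special c 2≤c half even , lower
    where
    open MakerBreaker (Edge n) (PerfectMatching n) 1
    lower : ∀ s → MakerWinsWithin s → suc ⌊ n /2⌋ ≤ s
    lower s win = ≤∧≢⇒< (subst (⌊ n /2⌋ ≤_) (*-identityʳ s) (edges≤claims 1 s win))
      λ { refl → no-perfect-play (suc c) (sym half) (≤-reflexive (trans even (cong (2 *_) (sym half))))
            (subst MakerWinsWithin (sym half) win) }

  tau : ∀ {a} c q → 0 < q → q ≤ a → 2 ≤ c → q + c * a ≡ ⌊ n /2⌋ →
    (2 ≤ a × 2 * ⌊ n /2⌋ ≤ n) ⊎ (q ≡ a × n ≡ suc (2 * ⌊ n /2⌋)) →
    MakerBreaker.IsTau (Edge n) (PerfectMatching n) a (suc c)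
  tau {a} c q 0<q q≤a 2≤c half cases = wins c q 0<q q≤a 2≤c half cases , λ s win →
    *-cancelʳ-< a c s (<-≤-trans (m<n+m (c * a) 0<q) (subst (_≤ s * a) (sym half) (edges≤claims a s win)))

theorem1p1 : ∀ (a : ℕ) .{{_ : NonZero a}} →
    ∃[ n₀ ] (∀ (n : ℕ) → n ≥ n₀ →
    MakerBreaker.IsTau (Edge n) (PerfectMatching n) a (optimalTime a n))
-- Beyond this bound ⌊n/2⌋ > 3 a, which gives at least two cleaning moves; for a = 1 it says
-- precisely ⌊n/2⌋ - 2 ≥ 2.
theorem1p1 a = 2 * suc (3 * a) , λ n n≥ →
  large n (≤-trans (≤-reflexive (half-double (suc (3 * a)))) (⌊n/2⌋-mono n≥))
  where
  half-double : ∀ m → m ≡ ⌊ 2 * m /2⌋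
  half-double m = trans (n≡⌊n+n/2⌋ m) (cong ⌊_/2⌋ (cong (m +_) (sym (+-identityʳ m))))

  large : ∀ n → 3 * a < ⌊ n /2⌋ → MakerBreaker.IsTau (Edge n) (PerfectMatching n) a (optimalTime a n)
  large n 3a<N = by-cases (even-or-odd n)
    where
    -- Dividing ⌊n/2⌋ - 1 puts q = `suc q′` between 1 and a, so that c + 1 is the ceiling of ⌊n/2⌋ /
    -- a.
    N′ = ⌊ n /2⌋ ∸ 1
    c = N′ / a
    q′ = N′ % a

    q≤a : suc q′ ≤ a
    q≤a = m%n<n N′ a

    half : suc q′ + c * a ≡ ⌊ n /2⌋
    half = trans (cong suc (sym (m≡m%n+[m/n]*n N′ a))) (m+[n∸m]≡n (≤-trans (s≤s z≤n) 3a<N))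

    2≤c : 2 ≤ c
    2≤c = ≤-trans (≤-trans (n≤1+n 2) (≤-reflexive (sym (m*n/n≡m 3 a)))) (/-monoˡ-≤ a (∸-monoˡ-≤ 1 3a<N))

    IsTau = MakerBreaker.IsTau (Edge n) (PerfectMatching n) a

    generic : ∀ ε → n ≡ ε + 2 * ⌊ n /2⌋ → 2 * q′ + ε + 2 ≤ 2 * a → 2 ≤ a →
      ¬ (a ≡ 1 × 2 ∣ n) → IsTau (optimalTime a n)
    generic ε n≡ small 2≤a ¬special = subst IsTau
      (sym (optimalTime-generic a n (2 * q′ + ε) c ¬special
        (trans n≡ (trans (cong (λ m → ε + 2 * m) (sym half)) (eq ε q′ c a)))
        (≤-trans (≤-reflexive (+-comm 2 _)) small)))
      (tau c (suc q′) z<s q≤a 2≤c half (inj₁ (2≤a , ≤-trans (m≤n+m _ ε) (≤-reflexive (sym n≡)))))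
      where
      eq : ∀ ε q c a → ε + 2 * (suc q + c * a) ≡ suc (suc (2 * q + ε)) + c * (2 * a)
      eq = solve-∀

    by-cases : n ≡ 2 * ⌊ n /2⌋ ⊎ n ≡ suc (2 * ⌊ n /2⌋) → IsTau (optimalTime a n)
    by-cases (inj₁ even) = even-case (a ≟ 1)
      where
      even-case : Dec (a ≡ 1) → IsTau (optimalTime a n)
      even-case (yes refl) = subst IsTau (sym (optimalTime-special 1 n refl even))
        (tau-special (⌊ n /2⌋ ∸ 2) (∸-monoˡ-≤ 2 3a<N) (m+[n∸m]≡n (≤-trans (s≤s (s≤s z≤n)) 3a<N)) even)
      even-case (no a≢1) = generic 0 even (≤-trans (≤-reflexive (eq q′)) (*-monoʳ-≤ 2 q≤a))
        (≤∧≢⇒< (>-nonZero⁻¹ a) (a≢1 ∘ sym)) (a≢1 ∘ proj₁)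
        where
        eq : ∀ q → 2 * q + 0 + 2 ≡ 2 * suc q
        eq = solve-∀

    by-cases (inj₂ odd) with suc q′ ≟ a
    ... | yes q≡a = subst IsTau (sym (optimalTime-exact a n c odd (subst (λ z → z + c * a ≡ _) q≡a half)))
      (tau c (suc q′) z<s q≤a 2≤c half (inj₂ (q≡a , odd)))
    -- From q < a follow both a ≥ 2 and 2 q + 1 < 2 a, so the odd vertex does not raise the ceiling.
    ... | no q≢a = generic 1 odd
      (≤-trans (≤-reflexive (eq q′)) (≤-trans (n≤1+n _)
        (≤-trans (≤-reflexive (eq′ q′)) (*-monoʳ-≤ 2 q<a))))
      (≤-trans (s≤s z<s) q<a) λ (_ , 2∣n) → 2∤1+2* ⌊ n /2⌋ (subst (2 ∣_) odd 2∣n)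
      where
      q<a : suc q′ < a
      q<a = ≤∧≢⇒< q≤a q≢a
      eq : ∀ q → 2 * q + 1 + 2 ≡ 2 * q + 3
      eq = solve-∀
      eq′ : ∀ q → suc (2 * q + 3) ≡ 2 * suc (suc q)
      eq′ = solve-∀
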